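{- The following $m$-equivalences between two-element sets of patterns of length three hold: (1) $\{111,123\}\sim\{111,132\}\sim\{111,213\}$; (2) $\{111,112\}\sim\{111,121\}$; (3) $\{112,123\}\sim\{112,213\}\sim\{121,132\}$; (4) $\{112,212\}\sim\{121,122\}$; (5) $\{121,123\}\sim\{121,213\}$. Moreover, this list is complete up to symmetry: on the collection of all sets consisting of two distinct patterns of length three, $m$-equivalence $\sim$ is the smallest equivalence relation $\approx$ that contains all the relations listed in (1)--(5), satisfies $P\approx P^r$ for every $P$, and is such that $P\approx Q$ implies $P^c\approx Q^c$.
   Context: A (finite, reduced) multiset is $S=1^{a_1}2^{a_2}\cdots k^{a_k}$ with $k\ge 1$ and all $a_i\ge 1$, meaning that $i$ occurs with multiplicity $a_i$. A multipermutation of $S$ is a word having exactly $a_i$ occurrences of each letter $i\in[k]=\{1,\dots,k\}$ and no other letters. A word $\pi=\pi_1\cdots\pi_n$ contains a pattern (word) $\rho=\rho_1\cdots\rho_\ell$ if there are indices $i(1)<\cdots<i(\ell)$ such that for all $a,b\in[\ell]$: $\pi_{i(a)}<\pi_{i(b)}$ iff $\rho_a<\rho_b$, and $\pi_{i(a)}>\pi_{i(b)}$ iff $\rho_a>\rho_b$; otherwise $\pi$ avoids $\rho$. For a set $P$ of patterns, $\mathrm{av}(S;P)$ is the number of multipermutations of $S$ that avoid every pattern in $P$. Two sets of patterns $P,Q$ are $m$-equivalent, written here $P\sim Q$, if $\mathrm{av}(S;P)=\mathrm{av}(S;Q)$ for every multiset $S$. Patterns of length three are the multipermutations of size three of reduced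 multisets, i.e. the 13 words $111$; $112,121,211$; $122,212,221$; $123,132,213,231,312,321$. For a word $\pi=\pi_1\cdots\pi_n$ with maximum letter $k$, the reversal is $\pi^r=\pi_n\cdots\pi_1$ and the complement is $\pi^c=(k+1-\pi_1)\cdots(k+1-\pi_n)$; for a set $P$ of patterns, $P^r$ and $P^c$ are obtained by applying the operation to each pattern in $P$. -}

module Defs where

open import Data.Fin.Base as Fin using (Fin; toℕ)
import Data.Fin.Properties as Finₚ
open import Data.List.Base
  using (List; []; _∷_; length; lookup; filter; map; reverse; upTo; foldr;
         cartesianProductWith)
open import Data.List.Membership.Propositional using (_∈_)
open import Data.List.Properties using (≡-dec; reverse-injective)
open import Data.List.Relation.Binary.BagAndSetEquality using (_∼[_]_; set)
open import Data.List.Relation.Unary.All as All using (All)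
open import Data.Nat.Base using (ℕ; zero; suc; _∸_; _⊔_; _≤_; _<_; _>_)
import Data.Nat.Properties as ℕₚ
open import Data.Product.Base using (∃; _×_; _,_; uncurry)
open import Data.Vec.Base as Vec using (Vec; []; _∷_)
import Data.Vec.Relation.Unary.All as Vecᴬ
open import Function.Base using (_∘_)
open import Function.Bundles using (_⇔_; mk⇔; Equivalence)
open import Relation.Binary.Definitions using (DecidableEquality)
open import Relation.Binary.PropositionalEquality using (_≡_; _≢_)
open import Relation.Nullary.Decidable
  using (Dec; yes; no; map′; _×-dec_; _→-dec_; ¬?; True; False; toWitness; toWitnessFalse)
open import Relation.Nullary.Negation using (¬_)
open import Relation.Unary using (Decidable)

-- The letters of [k] are the natural numbers 1, …, k.
Word : Set
Word = List ℕ

_≟ʷ_ : DecidableEquality Word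
_≟ʷ_ = ≡-dec ℕₚ._≟_

_∈?_ : (w : Word) (ws : List Word) → Dec (w ∈ ws)
_∈?_ = DecMembership._∈?_
  where import Data.List.Membership.DecPropositional _≟ʷ_ as DecMembership

record Multiset : Set where
  constructor multiset
  field
    size      : ℕ
    size≥1    : 1 ≤ size
    mult      : Vec ℕ size
    mult≥1    : Vecᴬ.All (1 ≤_) mult

open Multiset

occurrences : ℕ → Word → ℕ
occurrences x π = length (filter (x ℕₚ.≟_) π)

-- The entry of  mult S  at the (zero-based) index i is the multiplicity of the
-- letter  suc (toℕ i).
IsMultipermutation : Multiset → Word → Set
IsMultipermutation S π =
  All (λ x → 1 ≤ x × x ≤ size S) π ×
  (∀ (i : Fin (size S)) → occurrences (suc (toℕ i)) π ≡ Vec.lookup (mult S) i)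

isMultipermutation? : (S : Multiset) → Decidable (IsMultipermutation S)
isMultipermutation? S π =
  All.all? (λ x → (1 ℕₚ.≤? x) ×-dec (x ℕₚ.≤? size S)) π ×-dec
  Finₚ.all? (λ i → occurrences (suc (toℕ i)) π ℕₚ.≟ Vec.lookup (mult S) i)

-- i lists the positions i(1) < ⋯ < i(ℓ) in π of an occurrence of ρ.
IsOccurrence : (π ρ : Word) → Vec (Fin (length π)) (length ρ) → Set
IsOccurrence π ρ i =
  (∀ a b → a Fin.< b → Vec.lookup i a Fin.< Vec.lookup i b) ×
  (∀ a b →
    (lookup π (Vec.lookup i a) < lookup π (Vec.lookup i b) ⇔ lookup ρ a < lookup ρ b) ×
    (lookup π (Vec.lookup i a) > lookup π (Vec.lookup i b) ⇔ lookup ρ a > lookup ρ b))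

Contains : Word → Word → Set
Contains π ρ = ∃ (IsOccurrence π ρ)

Avoids : Word → Word → Set
Avoids π ρ = ¬ Contains π ρ

_⇔-dec_ : ∀ {A B : Set} → Dec A → Dec B → Dec (A ⇔ B)
a? ⇔-dec b? =
  map′ (uncurry mk⇔) (λ e → Equivalence.to e , Equivalence.from e)
       ((a? →-dec b?) ×-dec (b? →-dec a?))

anyVec? : ∀ {n ℓ} {Q : Vec (Fin n) ℓ → Set} → Decidable Q → Dec (∃ Q)
anyVec? {ℓ = zero}  Q? = map′ ([] ,_) (λ { ([] , q) → q }) (Q? [])
anyVec? {ℓ = suc ℓ} Q? =
  map′ (λ { (x , xs , q) → (x ∷ xs) , q }) (λ { ((x ∷ xs) , q) → x , xs , q })
       (Finₚ.any? (λ x → anyVec? (λ xs → Q? (x ∷ xs))))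

isOccurrence? : (π ρ : Word) → Decidable (IsOccurrence π ρ)
isOccurrence? π ρ i =
  Finₚ.all? (λ a → Finₚ.all? (λ b →
    (a Finₚ.<? b) →-dec (Vec.lookup i a Finₚ.<? Vec.lookup i b))) ×-dec
  Finₚ.all? (λ a → Finₚ.all? (λ b →
    ((lookup π (Vec.lookup i a) ℕₚ.<? lookup π (Vec.lookup i b))
      ⇔-dec (lookup ρ a ℕₚ.<? lookup ρ b)) ×-dec
    ((lookup π (Vec.lookup i a) ℕₚ.>? lookup π (Vec.lookup i b))
      ⇔-dec (lookup ρ a ℕₚ.>? lookup ρ b))))

contains? : (π ρ : Word) → Dec (Contains π ρ)
contains? π ρ = anyVec? (isOccurrence? π ρ)

avoids? : (π ρ : Word) → Dec (Avoids π ρ)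
avoids? π ρ = ¬? (contains? π ρ)

-- All words of length n over [k], each exactly once.
words : (k n : ℕ) → List Word
words k zero    = [] ∷ []
words k (suc n) = cartesianProductWith _∷_ (map suc (upTo k)) (words k n)

-- A finite set of patterns is given by a list of its elements.  Every
-- multipermutation of S has length a₁ + ⋯ + aₖ, so it is enumerated by `words`.
av : Multiset → List Word → ℕ
av S P =
  length (filter (λ π → isMultipermutation? S π ×-dec All.all? (avoids? π) P)
                 (words (size S) (Vec.sum (mult S))))

infix 4 _∼_ _≐_ _≈_

_∼_ : List Word → List Word → Set
P ∼ Q = ∀ (S : Multiset) → av S P ≡ av S Q

w111 w112 w121 w211 w122 w212 w221 w123 w132 w213 w231 w312 w321 : Word
w111 = 1 ∷ 1 ∷ 1 ∷ []
w112 = 1 ∷ 1 ∷ 2 ∷ []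
w121 = 1 ∷ 2 ∷ 1 ∷ []
w211 = 2 ∷ 1 ∷ 1 ∷ []
w122 = 1 ∷ 2 ∷ 2 ∷ []
w212 = 2 ∷ 1 ∷ 2 ∷ []
w221 = 2 ∷ 2 ∷ 1 ∷ []
w123 = 1 ∷ 2 ∷ 3 ∷ []
w132 = 1 ∷ 3 ∷ 2 ∷ []
w213 = 2 ∷ 1 ∷ 3 ∷ []
w231 = 2 ∷ 3 ∷ 1 ∷ []
w312 = 3 ∷ 1 ∷ 2 ∷ []
w321 = 3 ∷ 2 ∷ 1 ∷ []

patterns₃ : List Word
patterns₃ =
  w111 ∷ w112 ∷ w121 ∷ w211 ∷ w122 ∷ w212 ∷ w221 ∷
  w123 ∷ w132 ∷ w213 ∷ w231 ∷ w312 ∷ w321 ∷ []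

complement : Word → Word
complement π = map (λ x → suc (foldr _⊔_ 0 π) ∸ x) π

-- A set of two distinct patterns of length three, listed in some order; equality
-- of such sets is _≐_ below.
record PatternPair : Set where
  constructor patternPair
  field
    p q      : Word
    p∈       : p ∈ patterns₃
    q∈       : q ∈ patterns₃
    distinct : p ≢ q

  elements : List Word
  elements = p ∷ q ∷ []

open PatternPair

pair : (p q : Word) {_ : True (p ∈? patterns₃)} {_ : True (q ∈? patterns₃)}
       {_ : False (p ≟ʷ q)} → PatternPair
pair p q {p∈} {q∈} {p≢q} =
  patternPair p q (toWitness p∈) (toWitness q∈) (toWitnessFalse p≢q)

_≐_ : PatternPair → PatternPair → Set
P ≐ Q = elements P ∼[ set ] elements Q

reverse-patterns : All (λ ρ → reverse ρ ∈ patterns₃) patterns₃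
reverse-patterns = toWitness {a? = All.all? (λ ρ → reverse ρ ∈? patterns₃) patterns₃} _

complement-patterns : All (λ ρ → complement ρ ∈ patterns₃) patterns₃
complement-patterns = toWitness {a? = All.all? (λ ρ → complement ρ ∈? patterns₃) patterns₃} _

complement-distinct :
  All (λ ρ → All (λ σ → ρ ≢ σ → complement ρ ≢ complement σ) patterns₃) patterns₃
complement-distinct = toWitness
  {a? = All.all? (λ ρ → All.all? (λ σ →
          ¬? (ρ ≟ʷ σ) →-dec ¬? (complement ρ ≟ʷ complement σ)) patterns₃) patterns₃} _

infix 8 _ʳ _ᶜ

_ʳ : PatternPair → PatternPair
P ʳ = patternPair (reverse (p P)) (reverse (q P))
  (All.lookup reverse-patterns (p∈ P)) (All.lookup reverse-patterns (q∈ P))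
  (distinct P ∘ reverse-injective)

_ᶜ : PatternPair → PatternPair
P ᶜ = patternPair (complement (p P)) (complement (q P))
  (All.lookup complement-patterns (p∈ P)) (All.lookup complement-patterns (q∈ P))
  (All.lookup (All.lookup complement-distinct (p∈ P)) (q∈ P) (distinct P))

data Listed : PatternPair → PatternPair → Set where
  1a : Listed (pair w111 w123) (pair w111 w132)
  1b : Listed (pair w111 w132) (pair w111 w213)
  2a : Listed (pair w111 w112) (pair w111 w121)
  3a : Listed (pair w112 w123) (pair w112 w213)
  3b : Listed (pair w112 w213) (pair w121 w132)
  4a : Listed (pair w112 w212) (pair w121 w122)
  5a : Listed (pair w121 w123) (pair w121 w213)

-- Being inductively generated, this is the smallest equivalence relation (on
-- two-element sets, i.e. on pairs up to _≐_) with the three closure properties.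
data _≈_ : PatternPair → PatternPair → Set where
  listed          : ∀ {P Q} → Listed P Q → P ≈ Q
  by-reversal     : ∀ P → P ≈ P ʳ
  by-complement   : ∀ {P Q} → P ≈ Q → P ᶜ ≈ Q ᶜ
  reflexive       : ∀ {P Q} → P ≐ Q → P ≈ Q
  symmetric       : ∀ {P Q} → P ≈ Q → Q ≈ P
  transitive      : ∀ {P Q R} → P ≈ Q → Q ≈ R → P ≈ R

{-# OPTIONS --safe #-}

-- Build a multipermutation by inserting its letters from the largest to the
-- smallest.  If it is to avoid one of the given pairs, the places where copies of
-- a new least letter may go depend only on the number of "active sites" of the
-- word so far, and so do the numbers of active sites of the results.  Hence
-- av(S; P) is determined by a generating tree labelled by natural numbers, and
-- after reversal the two sides of each listed equivalence have the same tree.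
-- Reversal and complement preserve m-equivalence because they permute multisets
-- and multipermutations.  Conversely the listed relations and the symmetries
-- reduce every pair to one of 32 representatives, which are told apart by their
-- values on the multisets 1 2 3² 4, 1² 2² 3 and 1 2³ 3.

module Submission where

open import Defs
open import Algebra.Properties.CommutativeSemigroup using (interchange)
open import Data.Bool.Base using (true; false; if_then_else_)
open import Data.Fin.Base as Fin using (Fin; toℕ; opposite)
open import Data.Fin.Patterns using (0F; 1F; 2F)
open import Data.Fin.Properties using (toℕ<n; opposite-prop; opposite-involutive)
open import Data.List.Base hiding (_∷ʳ_; sum; find)
open import Data.List.Membership.Propositional using (_∈_; find; lose)
open import Data.List.Membership.Propositional.Properties
open import Data.List.Properties hiding (length-filter)
open import Data.List.Relation.Binary.Disjoint.Propositional using (Disjoint)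
open import Data.List.Relation.Binary.Permutation.Propositional using (↭-sym)
import Data.List.Relation.Binary.Permutation.Propositional.Properties as ↭ₚ
open import Data.List.Relation.Binary.Sublist.Propositional
  using (_⊆_; []; _∷_; _∷ʳ_; from∈; to∈; minimum; ⊆-trans; ⊆-refl)
import Data.List.Relation.Binary.Sublist.Propositional.Properties as ⊆ₚ
open import Data.List.Relation.Unary.All as All using (All; []; _∷_)
import Data.List.Relation.Unary.All.Properties as Allₚ
open import Data.List.Relation.Unary.AllPairs as AllPairs using ([]; _∷_)
import Data.List.Relation.Unary.AllPairs.Properties as AllPairsₚ
open import Data.List.Relation.Unary.Any as Any using (Any; here; there)
open import Data.List.Relation.Unary.Unique.Propositional using (Unique)
import Data.List.Relation.Unary.Unique.Propositional.Properties as Uniqueₚ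
open import Data.Nat.Base
open import Data.Nat.ListAction using (sum)
open import Data.Nat.Properties
open import Data.Nat.Tactic.RingSolver using (solve-∀)
open import Data.Product.Base using (∃; ∃₂; _×_; _,_; proj₁; proj₂)
open import Data.Product.Properties using () renaming (≡-dec to ×-≡-dec)
open import Data.Sum.Base using (_⊎_; inj₁; inj₂; [_,_]′)
open import Data.Unit.Base using (⊤; tt)
open import Data.Vec.Base as Vec using (Vec; []; _∷_)
import Data.Vec.Properties as Vecₚ
import Data.Vec.Relation.Unary.All as Vecᴬ
import Data.Vec.Relation.Unary.All.Properties as Vecᴬₚ
open import Function.Base using (_∘_; id; const)
open import Function.Bundles using (_⇔_; mk⇔; Equivalence)
open import Relation.Binary.PropositionalEquality
open import Relation.Nullary.Decidable
  using (Dec; yes; no; does; from-yes; map′; _×-dec_; _⊎-dec_; ¬?)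
open import Relation.Nullary.Negation using (¬_; contradiction)
open import Relation.Unary using (Decidable)

open Equivalence using (to; from)
open PatternPair

-- Reversal turns 123, 132, 213, 112, 122 into 321, 231, 312, 211, 221; afterwards the only 1 of a
-- pattern is never its first letter. A pattern ending in its only 1 constrains just the letters
-- before the last inserted copy, and a pattern with its only 1 in the middle just the letters on
-- the two sides of a copy. The copies themselves are governed by the other pattern of the pair: 121
-- forces them into one block, 211 forces all but the last to the front, 111 allows at most two. So
-- next to 121 or 211 a single site is chosen per insertion; only 111 with 231 or 321 leaves two
-- copies to place, and these become nested splits. The trees do not agree site by site: insertion
-- at the front gives for 321 the label that the last active site gives for 231. Rules therefore
-- speak of sums over all children, which a cyclic shift of the summands does not change.

module _ {A B : Set} where

  -- The left inverse `g` makes `f` injective on `xs`. Deleting one copy of `f x` from `ys` keeps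
  -- the images of all other entries, so induction applies.
  length-≤ : {xs : List A} {ys : List B} (f : A → B) (g : B → A) → Unique xs →
             (∀ {x} → x ∈ xs → f x ∈ ys) → (∀ {x} → x ∈ xs → g (f x) ≡ x) →
             length xs ≤ length ys
  length-≤ f g [] f∈ gf = z≤n
  length-≤ {x ∷ xs} f g (x≢ ∷ xs!) f∈ gf with ∈-∃++ (f∈ (here refl))
  ... | ys , zs , refl = begin
    suc (length xs)              ≤⟨ s≤s (length-≤ f g xs! f∈′ (gf ∘ there)) ⟩
    suc (length (ys ++ zs))      ≡⟨ cong suc (length-++ ys) ⟩
    suc (length ys + length zs)  ≡⟨ sym (+-suc (length ys) (length zs)) ⟩
    length ys + suc (length zs)  ≡⟨ sym (length-++ ys) ⟩
    length (ys ++ f x ∷ zs)      ∎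
    where
    open ≤-Reasoning
    f∈′ : ∀ {y} → y ∈ xs → f y ∈ ys ++ zs
    f∈′ {y} y∈ with ∈-++⁻ ys (f∈ (there y∈))
    ... | inj₁ fy∈          = ∈-++⁺ˡ fy∈
    ... | inj₂ (there fy∈)  = ∈-++⁺ʳ ys fy∈
    ... | inj₂ (here fy≡fx) = contradiction
      (trans (sym (gf (here refl))) (trans (cong g (sym fy≡fx)) (gf (there y∈))))
      (All.lookup x≢ y∈)

-- Multipermutations as iterated shuffles of the least letter

-- From here on letters count from 0: a word w stands for map suc w.  The words in
-- shuffles a u arise from map suc u by inserting a copies of the least letter.
shuffles : ℕ → Word → List Word
shuffles zero    u       = map suc u ∷ []
shuffles (suc a) []      = map (0 ∷_) (shuffles a [])
shuffles (suc a) (x ∷ u) =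
  map (0 ∷_) (shuffles a (x ∷ u)) ++ map (suc x ∷_) (shuffles (suc a) u)

arrangements : ∀ {k} → Vec ℕ k → List Word
arrangements []       = [] ∷ []
arrangements (a ∷ as) = concatMap (shuffles a) (arrangements as)

lower : Word → Word
lower []          = []
lower (zero  ∷ w) = lower w
lower (suc x ∷ w) = x ∷ lower w

lower-map-suc : ∀ u → lower (map suc u) ≡ u
lower-map-suc []      = refl
lower-map-suc (x ∷ u) = cong (x ∷_) (lower-map-suc u)

lower-++ : ∀ v w → lower (v ++ w) ≡ lower v ++ lower w
lower-++ []          w = refl
lower-++ (zero  ∷ v) w = lower-++ v w
lower-++ (suc x ∷ v) w = cong (x ∷_) (lower-++ v w)

occurrences-lower : ∀ x w → occurrences x (lower w) ≡ occurrences (suc x) w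
occurrences-lower x []          = refl
occurrences-lower x (zero  ∷ w) = occurrences-lower x w
occurrences-lower x (suc y ∷ w) with x ≟ y
... | yes x≡y = begin
  occurrences x (y ∷ lower w)      ≡⟨ cong length (filter-accept (x ≟_) x≡y) ⟩
  suc (occurrences x (lower w))    ≡⟨ cong suc (occurrences-lower x w) ⟩
  suc (occurrences (suc x) w)      ≡⟨ cong length (filter-accept (suc x ≟_) (cong suc x≡y)) ⟨
  occurrences (suc x) (suc y ∷ w)  ∎
  where open ≡-Reasoning
... | no x≢y = begin
  occurrences x (y ∷ lower w)      ≡⟨ cong length (filter-reject (x ≟_) x≢y) ⟩
  occurrences x (lower w)          ≡⟨ occurrences-lower x w ⟩
  occurrences (suc x) w            ≡⟨ cong length (filter-reject (suc x ≟_) (x≢y ∘ suc-injective)) ⟨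
  occurrences (suc x) (suc y ∷ w)  ∎
  where open ≡-Reasoning

occurrences-0-map-suc : ∀ u → occurrences 0 (map suc u) ≡ 0
occurrences-0-map-suc []      = refl
occurrences-0-map-suc (x ∷ u) = occurrences-0-map-suc u

∈-shuffles⁻ : ∀ a u {w} → w ∈ shuffles a u → lower w ≡ u × occurrences 0 w ≡ a
∈-shuffles⁻ zero u (here refl) = lower-map-suc u , occurrences-0-map-suc u
∈-shuffles⁻ (suc a) [] w∈ with ∈-map⁻ (0 ∷_) w∈
... | v , v∈ , refl with ∈-shuffles⁻ a [] v∈
...   | eq , eq′ = eq , cong suc eq′
∈-shuffles⁻ (suc a) (x ∷ u) w∈ with ∈-++⁻ (map (0 ∷_) (shuffles a (x ∷ u))) w∈
... | inj₁ w∈ˡ with ∈-map⁻ (0 ∷_) w∈ˡ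
...   | v , v∈ , refl with ∈-shuffles⁻ a (x ∷ u) v∈
...     | eq , eq′ = eq , cong suc eq′
∈-shuffles⁻ (suc a) (x ∷ u) w∈ | inj₂ w∈ʳ with ∈-map⁻ (suc x ∷_) w∈ʳ
...   | v , v∈ , refl with ∈-shuffles⁻ (suc a) u v∈
...     | eq , eq′ = cong (x ∷_) eq , eq′

0∷-∈-shuffles : ∀ a u {w} → w ∈ shuffles a u → 0 ∷ w ∈ shuffles (suc a) u
0∷-∈-shuffles a []      w∈ = ∈-map⁺ (0 ∷_) w∈
0∷-∈-shuffles a (x ∷ u) w∈ = ∈-++⁺ˡ (∈-map⁺ (0 ∷_) w∈)

suc∷-∈-shuffles : ∀ a x u {w} → w ∈ shuffles a u → suc x ∷ w ∈ shuffles a (x ∷ u)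
suc∷-∈-shuffles zero    x u (here refl) = here refl
suc∷-∈-shuffles (suc a) x u w∈ =
  ∈-++⁺ʳ (map (0 ∷_) (shuffles a (x ∷ u))) (∈-map⁺ (suc x ∷_) w∈)

∈-shuffles⁺ : ∀ w → w ∈ shuffles (occurrences 0 w) (lower w)
∈-shuffles⁺ []          = here refl
∈-shuffles⁺ (zero  ∷ w) = 0∷-∈-shuffles (occurrences 0 w) (lower w) (∈-shuffles⁺ w)
∈-shuffles⁺ (suc x ∷ w) = suc∷-∈-shuffles (occurrences 0 w) x (lower w) (∈-shuffles⁺ w)

∷-injectiveʳ′ : ∀ {x : ℕ} {v w : Word} → x ∷ v ≡ x ∷ w → v ≡ w
∷-injectiveʳ′ refl = refl

shuffles-unique : ∀ a u → Unique (shuffles a u)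
shuffles-unique zero    u       = [] ∷ []
shuffles-unique (suc a) []      = Uniqueₚ.map⁺ ∷-injectiveʳ′ (shuffles-unique a [])
shuffles-unique (suc a) (x ∷ u) = Uniqueₚ.++⁺
  (Uniqueₚ.map⁺ ∷-injectiveʳ′ (shuffles-unique a (x ∷ u)))
  (Uniqueₚ.map⁺ ∷-injectiveʳ′ (shuffles-unique (suc a) u))
  disjoint
  where
  disjoint : Disjoint (map (0 ∷_) (shuffles a (x ∷ u))) (map (suc x ∷_) (shuffles (suc a) u))
  disjoint (v∈ , v∈′) with ∈-map⁻ (0 ∷_) v∈ | ∈-map⁻ (suc x ∷_) v∈′
  ... | _ , _ , refl | _ , _ , ()

arrangements-unique : ∀ {k} (as : Vec ℕ k) → Unique (arrangements as)
arrangements-unique []       = [] ∷ []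
arrangements-unique (a ∷ as) = Uniqueₚ.concat⁺
  (Allₚ.map⁺ (All.universal (shuffles-unique a) (arrangements as)))
  (AllPairsₚ.map⁺ (AllPairs.map disjoint (arrangements-unique as)))
  where
  disjoint : ∀ {u v} → u ≢ v → Disjoint (shuffles a u) (shuffles a v)
  disjoint {u} {v} u≢v (w∈ , w∈′) =
    u≢v (trans (sym (proj₁ (∈-shuffles⁻ a u w∈))) (proj₁ (∈-shuffles⁻ a v w∈′)))

HasContent : ∀ {k} → Vec ℕ k → Word → Set
HasContent {k} as w =
  All (_< k) w × (∀ i → occurrences (toℕ i) w ≡ Vec.lookup as i)

lower-<⁺ : ∀ {k} w → All (_< suc k) w → All (_< k) (lower w)
lower-<⁺ []          []          = []
lower-<⁺ (zero  ∷ w) (_ ∷ <k)     = lower-<⁺ w <k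
lower-<⁺ (suc x ∷ w) (s<s x< ∷ <k) = x< ∷ lower-<⁺ w <k

lower-<⁻ : ∀ {k} w → All (_< k) (lower w) → All (_< suc k) w
lower-<⁻ []          []       = []
lower-<⁻ (zero  ∷ w) <k       = z<s ∷ lower-<⁻ w <k
lower-<⁻ (suc x ∷ w) (x< ∷ <k) = s<s x< ∷ lower-<⁻ w <k

∈-concatMap-find : ∀ {A B : Set} (f : A → List B) {y} xs → y ∈ concatMap f xs →
                   ∃ λ x → x ∈ xs × y ∈ f x
∈-concatMap-find f xs y∈ with find (∈-concatMap⁻ f {xs = xs} y∈)
... | x , x∈ , y∈′ = x , x∈ , y∈′

∈-arrangements⁻ : ∀ {k} (as : Vec ℕ k) {w} → w ∈ arrangements as → HasContent as w
∈-arrangements⁻ [] (here refl) = [] , λ ()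
∈-arrangements⁻ (a ∷ as) {w} w∈ with ∈-concatMap-find (shuffles a) (arrangements as) w∈
... | u , u∈ , w∈′ with ∈-shuffles⁻ a u w∈′ | ∈-arrangements⁻ as u∈
...   | refl , occ₀ | <k , occ = lower-<⁻ w <k , λ
  { Fin.zero    → occ₀
  ; (Fin.suc i) → trans (sym (occurrences-lower (toℕ i) w)) (occ i) }

∈-arrangements⁺ : ∀ {k} (as : Vec ℕ k) w → HasContent as w → w ∈ arrangements as
∈-arrangements⁺ [] []      _              = here refl
∈-arrangements⁺ [] (x ∷ w) (() ∷ _ , _)
∈-arrangements⁺ (a ∷ as) w (<k , occ) = ∈-concatMap⁺ (shuffles a)
  (lose (∈-arrangements⁺ as (lower w)
          (lower-<⁺ w <k , λ i → trans (occurrences-lower (toℕ i) w) (occ (Fin.suc i))))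
        (subst (λ n → w ∈ shuffles n (lower w)) (occ Fin.zero) (∈-shuffles⁺ w)))

length-lower : ∀ w → length w ≡ occurrences 0 w + length (lower w)
length-lower []          = refl
length-lower (zero  ∷ w) = cong suc (length-lower w)
length-lower (suc x ∷ w) = trans (cong suc (length-lower w)) (sym (+-suc _ _))

-- `av` searches only the words of length `Vec.sum mult`; this places every word of the right
-- content among them.
length-content : ∀ {k} (as : Vec ℕ k) w → HasContent as w → length w ≡ Vec.sum as
length-content []       []      _            = refl
length-content []       (x ∷ w) (() ∷ _ , _)
length-content (a ∷ as) w (<k , occ) = trans (length-lower w) (cong₂ _+_ (occ Fin.zero)
  (length-content as (lower w)
    (lower-<⁺ w <k , λ i → trans (occurrences-lower (toℕ i) w) (occ (Fin.suc i)))))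

words-unique : ∀ k n → Unique (words k n)
words-unique k zero    = [] ∷ []
words-unique k (suc n) = Uniqueₚ.cartesianProductWith⁺ _∷_ (λ { refl → refl , refl })
  (Uniqueₚ.map⁺ suc-injective (Uniqueₚ.upTo⁺ k)) (words-unique k n)

∈-words : ∀ k w → All (_< k) w → map suc w ∈ words k (length w)
∈-words k []      []       = here refl
∈-words k (x ∷ w) (x< ∷ <k) =
  ∈-cartesianProductWith⁺ _∷_ (∈-map⁺ suc (∈-upTo⁺ x<)) (∈-words k w <k)

occurrences-map-suc : ∀ x w → occurrences (suc x) (map suc w) ≡ occurrences x w
occurrences-map-suc x w =
  trans (sym (occurrences-lower x (map suc w))) (cong (occurrences x) (lower-map-suc w))

lettersBelow⁻ : ∀ {k} π → All (λ x → 1 ≤ x × x ≤ k) π →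
                π ≡ map suc (map pred π) × All (_< k) (map pred π)
lettersBelow⁻ []          []                    = refl , []
lettersBelow⁻ (suc x ∷ π) ((s≤s _ , x≤) ∷ rest) with lettersBelow⁻ π rest
... | eq , <k = cong (suc x ∷_) eq , x≤ ∷ <k

lettersBelow⁺ : ∀ {k} w → All (_< k) w → All (λ x → 1 ≤ x × x ≤ k) (map suc w)
lettersBelow⁺ w <k = Allₚ.map⁺ (All.map (λ x< → s≤s z≤n , x<) <k)

multipermutation⇒content : ∀ S π → IsMultipermutation S π →
  π ≡ map suc (map pred π) × HasContent (Multiset.mult S) (map pred π)
multipermutation⇒content S π (letters , occ) with lettersBelow⁻ π letters
... | eq , <k = eq , <k , λ i →
  trans (sym (occurrences-map-suc (toℕ i) (map pred π)))
        (trans (cong (occurrences (suc (toℕ i))) (sym eq)) (occ i))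

content⇒multipermutation : ∀ S w → HasContent (Multiset.mult S) w →
                           IsMultipermutation S (map suc w)
content⇒multipermutation S w (<k , occ) =
  lettersBelow⁺ w <k , λ i → trans (occurrences-map-suc (toℕ i) w) (occ i)

map-pred-map-suc : ∀ w → map pred (map suc w) ≡ w
map-pred-map-suc []      = refl
map-pred-map-suc (x ∷ w) = cong (x ∷_) (map-pred-map-suc w)

module _ {A : Word → Set} (A? : Decidable A) (S : Multiset) (P : List Word)
         (A⇒ : ∀ w → A w → All (Avoids (map suc w)) P)
         (A⇐ : ∀ w → All (Avoids (map suc w)) P → A w) where

  open Multiset S

  -- `map suc` and `map pred` are inverse to each other here. The predicate `A` is left open because
  -- two tests are plugged in: `avoidsAll?` for the trees and the quicker `misses?` for the
  -- numerical separation.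
  av≡length : av S P ≡ length (filter A? (arrangements mult))
  av≡length = ≤-antisym
    (length-≤ (map pred) (map suc) (Uniqueₚ.filter⁺ _ (words-unique size (Vec.sum mult)))
      pred∈ (λ π∈ → sym (proj₁ (multipermutation⇒content S _ (proj₁ (good π∈))))))
    (length-≤ (map suc) (map pred) (Uniqueₚ.filter⁺ A? (arrangements-unique mult))
      suc∈ (λ {w} _ → map-pred-map-suc w))
    where
    good? : Decidable (λ π → IsMultipermutation S π × All (Avoids π) P)
    good? π = isMultipermutation? S π ×-dec All.all? (avoids? π) P
    good : ∀ {π} → π ∈ filter good? (words size (Vec.sum mult)) →
           IsMultipermutation S π × All (Avoids π) P
    good π∈ = proj₂ (∈-filter⁻ good? {xs = words size (Vec.sum mult)} π∈)
    pred∈ : ∀ {π} → π ∈ filter good? (words size (Vec.sum mult)) →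
         map pred π ∈ filter A? (arrangements mult)
    pred∈ {π} π∈ with good π∈
    ... | multi , avoids with multipermutation⇒content S π multi
    ...   | eq , content = ∈-filter⁺ A? (∈-arrangements⁺ mult _ content)
      (A⇐ _ (subst (λ π → All (Avoids π) P) eq avoids))
    suc∈ : ∀ {w} → w ∈ filter A? (arrangements mult) →
           map suc w ∈ filter good? (words size (Vec.sum mult))
    suc∈ {w} w∈ with ∈-filter⁻ A? {xs = arrangements mult} w∈
    ... | w∈′ , Aw with ∈-arrangements⁻ mult w∈′
    ...   | content = ∈-filter⁺ good?
      (subst (λ n → map suc w ∈ words size n) (length-content mult w content)
             (∈-words size w (proj₁ content)))
      (content⇒multipermutation S w content , A⇒ w Aw)

-- Occurrences of patterns of length three as sublists

SameOrder : (a b x y : ℕ) → Set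
SameOrder a b x y = (x < y ⇔ a < b) × (x > y ⇔ a > b)

-- SameOrder a b, reduced to the one comparison that holds; it computes when a
-- and b are literals.
Like : (a b x y : ℕ) → Set
Like zero    zero    x y = x ≡ y
Like zero    (suc b) x y = x < y
Like (suc a) zero    x y = x > y
Like (suc a) (suc b) x y = Like a b x y

sameOrder⇒like : ∀ a b {x y} → SameOrder a b x y → Like a b x y
sameOrder⇒like zero    zero    (lt , gt) =
  ≤-antisym (≮⇒≥ (λ x>y → contradiction (to gt x>y) λ ())) (≮⇒≥ (λ x<y → contradiction (to lt x<y) λ ()))
sameOrder⇒like zero    (suc b) (lt , gt) = from lt z<s
sameOrder⇒like (suc a) zero    (lt , gt) = from gt z<s
sameOrder⇒like (suc a) (suc b) (lt , gt) = sameOrder⇒like a b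
  (mk⇔ (s<s⁻¹ ∘ to lt) (from lt ∘ s<s) , mk⇔ (s<s⁻¹ ∘ to gt) (from gt ∘ s<s))

like⇒sameOrder : ∀ a b {x y} → Like a b x y → SameOrder a b x y
like⇒sameOrder zero    zero    refl =
  mk⇔ (λ x<x → contradiction x<x (<-irrefl refl)) (λ ()) ,
  mk⇔ (λ x<x → contradiction x<x (<-irrefl refl)) (λ ())
like⇒sameOrder zero    (suc b) x<y =
  mk⇔ (λ _ → z<s) (λ _ → x<y) , mk⇔ (λ x>y → contradiction x>y (<-asym x<y)) (λ ())
like⇒sameOrder (suc a) zero    x>y =
  mk⇔ (λ x<y → contradiction x<y (<-asym x>y)) (λ ()) , mk⇔ (λ _ → z<s) (λ _ → x>y)
like⇒sameOrder (suc a) (suc b) like with like⇒sameOrder a b like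
... | lt , gt = mk⇔ (s<s ∘ to lt) (from lt ∘ s<s⁻¹) , mk⇔ (s<s ∘ to gt) (from gt ∘ s<s⁻¹)

like-suc : ∀ a b {x y} → Like a b x y → Like a b (suc x) (suc y)
like-suc zero    zero    = cong suc
like-suc zero    (suc b) = s<s
like-suc (suc a) zero    = s<s
like-suc (suc a) (suc b) = like-suc a b

like-pred : ∀ a b {x y} → Like a b (suc x) (suc y) → Like a b x y
like-pred zero    zero    = suc-injective
like-pred zero    (suc b) = s<s⁻¹
like-pred (suc a) zero    = s<s⁻¹
like-pred (suc a) (suc b) = like-pred a b

like-swap : ∀ a b {x y} → Like a b x y → Like b a y x
like-swap zero    zero    = sym
like-swap zero    (suc b) = id
like-swap (suc a) zero    = id
like-swap (suc a) (suc b) = like-swap a b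

like? : ∀ a b x y → Dec (Like a b x y)
like? zero    zero    x y = x ≟ y
like? zero    (suc b) x y = x <? y
like? (suc a) zero    x y = y <? x
like? (suc a) (suc b) x y = like? a b x y

∸-reverses-< : ∀ {m x y} → x ≤ m → y ≤ m → x < y ⇔ m ∸ x > m ∸ y
∸-reverses-< {m} x≤m y≤m = mk⇔ (λ x<y → ∸-monoʳ-< x<y y≤m) ∸-cancelʳ-<

-- `Like` does not compute at `m ∸ a` for a variable `a`, so the argument passes through
-- `SameOrder`, where complementing just exchanges `<` and `>`.
like-complement : ∀ {m k} a b {x y} → a ≤ m → b ≤ m → x ≤ k → y ≤ k →
                  Like a b x y → Like (m ∸ a) (m ∸ b) (k ∸ x) (k ∸ y)
like-complement {m} {k} a b a≤ b≤ x≤ y≤ like with like⇒sameOrder a b like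
... | lt , gt = sameOrder⇒like (m ∸ a) (m ∸ b)
  ( mk⇔ (to (∸-reverses-< b≤ a≤) ∘ to gt ∘ from (∸-reverses-< y≤ x≤))
        (to (∸-reverses-< y≤ x≤) ∘ from gt ∘ from (∸-reverses-< b≤ a≤))
  , mk⇔ (to (∸-reverses-< a≤ b≤) ∘ to lt ∘ from (∸-reverses-< x≤ y≤))
        (to (∸-reverses-< x≤ y≤) ∘ from lt ∘ from (∸-reverses-< a≤ b≤)))

TripleRelation : Set₁
TripleRelation = ℕ → ℕ → ℕ → Set

Occurs : TripleRelation → Word → Set
Occurs T w = ∃ λ x → ∃ λ y → ∃ λ z → (x ∷ y ∷ z ∷ []) ⊆ w × T x y z

-- The third comparison is independent information: 132 and 231 agree in the first two.
Pattern : (a b c : ℕ) → TripleRelation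
Pattern a b c x y z = Like a b x y × Like b c y z × Like a c x z

sublist₁ : ∀ (π : Word) i → (lookup π i ∷ []) ⊆ π
sublist₁ π i = from∈ (∈-lookup {xs = π} i)

sublist₂ : ∀ (π : Word) i j → i Fin.< j → (lookup π i ∷ lookup π j ∷ []) ⊆ π
sublist₂ (x ∷ π) Fin.zero    (Fin.suc j) _   = refl ∷ sublist₁ π j
sublist₂ (x ∷ π) (Fin.suc i) (Fin.suc j) i<j = x ∷ʳ sublist₂ π i j (s<s⁻¹ i<j)

sublist₃ : ∀ (π : Word) i j k → i Fin.< j → j Fin.< k →
           (lookup π i ∷ lookup π j ∷ lookup π k ∷ []) ⊆ π
sublist₃ (x ∷ π) Fin.zero    (Fin.suc j) (Fin.suc k) _   j<k =
  refl ∷ sublist₂ π j k (s<s⁻¹ j<k)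
sublist₃ (x ∷ π) (Fin.suc i) (Fin.suc j) (Fin.suc k) i<j j<k =
  x ∷ʳ sublist₃ π i j k (s<s⁻¹ i<j) (s<s⁻¹ j<k)

position : ∀ {σ π : Word} → σ ⊆ π → Fin (length σ) → Fin (length π)
position (y ∷ʳ τ) i           = Fin.suc (position τ i)
position (_ ∷ τ)  Fin.zero    = Fin.zero
position (_ ∷ τ)  (Fin.suc i) = Fin.suc (position τ i)

position-< : ∀ {σ π : Word} (τ : σ ⊆ π) {i j} → i Fin.< j → position τ i Fin.< position τ j
position-< (y ∷ʳ τ) i<j = s<s (position-< τ i<j)
position-< (_ ∷ τ) {Fin.zero}  {Fin.suc j} _   = z<s
position-< (_ ∷ τ) {Fin.suc i} {Fin.suc j} i<j = s<s (position-< τ (s<s⁻¹ i<j))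

lookup-position : ∀ {σ π : Word} (τ : σ ⊆ π) i → lookup π (position τ i) ≡ lookup σ i
lookup-position (y ∷ʳ τ)   i           = lookup-position τ i
lookup-position (refl ∷ τ) Fin.zero    = refl
lookup-position (refl ∷ τ) (Fin.suc i) = lookup-position τ i

module _ {a b c : ℕ} where

  contains⇒occurs : ∀ π → Contains π (a ∷ b ∷ c ∷ []) → Occurs (Pattern a b c) π
  contains⇒occurs π (i ∷ j ∷ k ∷ [] , increasing , same) =
    lookup π i , lookup π j , lookup π k ,
    sublist₃ π i j k (increasing 0F 1F z<s) (increasing 1F 2F (s<s z<s)) ,
    sameOrder⇒like a b (same 0F 1F) , sameOrder⇒like b c (same 1F 2F) , sameOrder⇒like a c (same 0F 2F)

  occurs⇒contains : ∀ π → Occurs (Pattern a b c) π → Contains π (a ∷ b ∷ c ∷ [])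
  occurs⇒contains π (x , y , z , τ , xy , yz , xz) =
    Vec.tabulate (position τ) , increasing , same
    where
    σ ρ : Word
    σ = x ∷ y ∷ z ∷ []
    ρ = a ∷ b ∷ c ∷ []
    increasing : ∀ i j → i Fin.< j →
      Vec.lookup (Vec.tabulate (position τ)) i Fin.< Vec.lookup (Vec.tabulate (position τ)) j
    increasing i j i<j
      rewrite Vecₚ.lookup∘tabulate (position τ) i | Vecₚ.lookup∘tabulate (position τ) j =
      position-< τ i<j
    irrefl : ∀ d {u} → SameOrder d d u u
    irrefl d = mk⇔ (λ u<u → contradiction u<u (<-irrefl refl)) (λ d<d → contradiction d<d (<-irrefl refl)) ,
               mk⇔ (λ u<u → contradiction u<u (<-irrefl refl)) (λ d<d → contradiction d<d (<-irrefl refl))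
    same-σ : ∀ i j → SameOrder (lookup ρ i) (lookup ρ j) (lookup σ i) (lookup σ j)
    same-σ 0F 0F = irrefl a
    same-σ 0F 1F = like⇒sameOrder a b xy
    same-σ 0F 2F = like⇒sameOrder a c xz
    same-σ 1F 0F = like⇒sameOrder b a (like-swap a b xy)
    same-σ 1F 1F = irrefl b
    same-σ 1F 2F = like⇒sameOrder b c yz
    same-σ 2F 0F = like⇒sameOrder c a (like-swap a c xz)
    same-σ 2F 1F = like⇒sameOrder c b (like-swap b c yz)
    same-σ 2F 2F = irrefl c
    same : ∀ i j → SameOrder (lookup ρ i) (lookup ρ j)
      (lookup π (Vec.lookup (Vec.tabulate (position τ)) i))
      (lookup π (Vec.lookup (Vec.tabulate (position τ)) j))
    same i j
      rewrite Vecₚ.lookup∘tabulate (position τ) i | Vecₚ.lookup∘tabulate (position τ) j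
            | lookup-position τ i | lookup-position τ j = same-σ i j

⊆-map⁻ : ∀ (f : ℕ → ℕ) w {σ} → σ ⊆ map f w → ∃ λ τ → σ ≡ map f τ × τ ⊆ w
⊆-map⁻ f []      []       = [] , refl , []
⊆-map⁻ f (x ∷ w) (_ ∷ʳ s) with ⊆-map⁻ f w s
... | τ , eq , τ⊆ = τ , eq , x ∷ʳ τ⊆
⊆-map⁻ f (x ∷ w) (refl ∷ s) with ⊆-map⁻ f w s
... | τ , eq , τ⊆ = x ∷ τ , cong (f x ∷_) eq , refl ∷ τ⊆

module _ (a b c : ℕ) where

  pattern-suc : ∀ {x y z} → Pattern a b c x y z → Pattern a b c (suc x) (suc y) (suc z)
  pattern-suc (xy , yz , xz) = like-suc a b xy , like-suc b c yz , like-suc a c xz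

  pattern-pred : ∀ {x y z} → Pattern a b c (suc x) (suc y) (suc z) → Pattern a b c x y z
  pattern-pred (xy , yz , xz) = like-pred a b xy , like-pred b c yz , like-pred a c xz

  occurs-map-suc⁺ : ∀ {w} → Occurs (Pattern a b c) w → Occurs (Pattern a b c) (map suc w)
  occurs-map-suc⁺ (_ , _ , _ , τ , p) = _ , _ , _ , ⊆ₚ.map⁺ suc τ , pattern-suc p

  occurs-map-suc⁻ : ∀ {w} → Occurs (Pattern a b c) (map suc w) → Occurs (Pattern a b c) w
  occurs-map-suc⁻ {w} (_ , _ , _ , τ , p) with ⊆-map⁻ suc w τ
  ... | _ ∷ _ ∷ _ ∷ [] , refl , τ′ = _ , _ , _ , τ′ , pattern-pred p

  occurs-reverse : ∀ {w} → Occurs (Pattern a b c) w → Occurs (Pattern c b a) (reverse w)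
  occurs-reverse (_ , _ , _ , τ , xy , yz , xz) =
    _ , _ , _ , ⊆ₚ.reverse⁺ τ , like-swap b c yz , like-swap a b xy , like-swap a c xz

  -- The occurrence keeps its positions, and every comparison is flipped twice. Any upper bounds `m`
  -- and `k` on the letters will do, which suits `complement` (one more than the maximum) as well as
  -- words over letters from 0.
  occurs-complement : ∀ {m k w} → a ≤ m → b ≤ m → c ≤ m → All (_≤ k) w →
    Occurs (Pattern a b c) (map (k ∸_) w) → Occurs (Pattern (m ∸ a) (m ∸ b) (m ∸ c)) w
  occurs-complement {m} {k} {w} a≤ b≤ c≤ w≤ (_ , _ , _ , τ , xy , yz , xz) with ⊆-map⁻ (k ∸_) w τ
  ... | x ∷ y ∷ z ∷ [] , refl , τ′ with ⊆ₚ.All-resp-⊆ τ′ w≤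
  ...   | x≤ ∷ y≤ ∷ z≤ ∷ [] = _ , _ , _ , τ′ ,
    like a b x y a≤ b≤ x≤ y≤ xy , like b c y z b≤ c≤ y≤ z≤ yz , like a c x z a≤ c≤ x≤ z≤ xz
    where
    like : ∀ d e u v → d ≤ m → e ≤ m → u ≤ k → v ≤ k →
           Like d e (k ∸ u) (k ∸ v) → Like (m ∸ d) (m ∸ e) u v
    like d e u v d≤ e≤ u≤ v≤ l = subst₂ (Like (m ∸ d) (m ∸ e)) (m∸[m∸n]≡n u≤) (m∸[m∸n]≡n v≤)
      (like-complement d e d≤ e≤ (m∸n≤m k u) (m∸n≤m k v) l)

avoids-transfer : ∀ {a b c d e f} π π′ →
  (Occurs (Pattern d e f) π′ → Occurs (Pattern a b c) π) →
  Avoids π (a ∷ b ∷ c ∷ []) → Avoids π′ (d ∷ e ∷ f ∷ [])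
avoids-transfer π π′ occ av con = av (occurs⇒contains π (occ (contains⇒occurs π′ con)))

LengthThree : Word → Set
LengthThree ρ = ∃ λ a → ∃ λ b → ∃ λ c → ρ ≡ a ∷ b ∷ c ∷ []

avoids-all-suc⁺ : ∀ {P} → All LengthThree P → ∀ w → All (Avoids w) P → All (Avoids (map suc w)) P
avoids-all-suc⁺ []                              w []       = []
avoids-all-suc⁺ ((a , b , c , refl) ∷ three) w (av ∷ avs) =
  avoids-transfer w (map suc w) (occurs-map-suc⁻ a b c) av ∷
  avoids-all-suc⁺ three w avs

avoids-all-suc⁻ : ∀ {P} → All LengthThree P → ∀ w → All (Avoids (map suc w)) P → All (Avoids w) P
avoids-all-suc⁻ []                              w []       = []
avoids-all-suc⁻ ((a , b , c , refl) ∷ three) w (av ∷ avs) =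
  avoids-transfer (map suc w) w (occurs-map-suc⁺ a b c) av ∷
  avoids-all-suc⁻ three w avs

-- Opaque, so that comparing types never unfolds the search for occurrences.
opaque
  avoidsAll? : ∀ P → Decidable (λ w → All (Avoids w) P)
  avoidsAll? P w = All.all? (avoids? w) P

av≡arrangements : ∀ {P} → All LengthThree P → ∀ S →
  av S P ≡ length (filter (avoidsAll? P) (arrangements (Multiset.mult S)))
av≡arrangements {P} three S =
  av≡length (avoidsAll? P) S P (avoids-all-suc⁺ three) (avoids-all-suc⁻ three)

-- Invariance under set equality, reversal and complement

-- Reversal and complement are involutions, so each of them yields an equality by using this
-- inequality in both directions.
av-≤ : ∀ {P Q} → All LengthThree P → All LengthThree Q → ∀ S S′ (f g : Word → Word) →
  (∀ w → HasContent (Multiset.mult S) w → HasContent (Multiset.mult S′) (f w) × g (f w) ≡ w) →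
  (∀ w → HasContent (Multiset.mult S) w → All (Avoids w) P → All (Avoids (f w)) Q) →
  av S P ≤ av S′ Q
av-≤ {P} {Q} threeᴾ threeᑫ S S′ f g content avoids = begin
  av S P                                         ≡⟨ av≡arrangements threeᴾ S ⟩
  length (filter (avoidsAll? P) (arrangements as))  ≤⟨
    length-≤ f g (Uniqueₚ.filter⁺ (avoidsAll? P) (arrangements-unique as)) f∈ gf ⟩
  length (filter (avoidsAll? Q) (arrangements as′)) ≡⟨ av≡arrangements threeᑫ S′ ⟨
  av S′ Q                                        ∎
  where
  open ≤-Reasoning
  as  = Multiset.mult S
  as′ = Multiset.mult S′
  f∈ : ∀ {w} → w ∈ filter (avoidsAll? P) (arrangements as) →
       f w ∈ filter (avoidsAll? Q) (arrangements as′)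
  f∈ {w} w∈ with ∈-filter⁻ (avoidsAll? P) {xs = arrangements as} w∈
  ... | w∈′ , av with ∈-arrangements⁻ as w∈′
  ...   | has = ∈-filter⁺ (avoidsAll? Q) (∈-arrangements⁺ as′ (f w) (proj₁ (content w has)))
                          (avoids w has av)
  gf : ∀ {w} → w ∈ filter (avoidsAll? P) (arrangements as) → g (f w) ≡ w
  gf {w} w∈ with ∈-filter⁻ (avoidsAll? P) {xs = arrangements as} w∈
  ... | w∈′ , _ = proj₂ (content w (∈-arrangements⁻ as w∈′))

av-⊆ : ∀ {P Q} → All LengthThree P → All LengthThree Q → (∀ {ρ} → ρ ∈ Q → ρ ∈ P) →
       ∀ S → av S P ≤ av S Q
av-⊆ threeᴾ threeᑫ Q⊆P S = av-≤ threeᴾ threeᑫ S S id id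
  (λ w has → has , refl) (λ w _ avoids → All.tabulate (λ ρ∈ → All.lookup avoids (Q⊆P ρ∈)))

occurrences-++ : ∀ x v w → occurrences x (v ++ w) ≡ occurrences x v + occurrences x w
occurrences-++ x v w = trans (cong length (filter-++ (x ≟_) v w)) (length-++ (filter (x ≟_) v))

occurrences-reverse : ∀ x w → occurrences x (reverse w) ≡ occurrences x w
occurrences-reverse x []      = refl
occurrences-reverse x (y ∷ w) = begin
  occurrences x (reverse (y ∷ w))                 ≡⟨ cong (occurrences x) (unfold-reverse y w) ⟩
  occurrences x (reverse w ++ y ∷ [])             ≡⟨ occurrences-++ x (reverse w) (y ∷ []) ⟩
  occurrences x (reverse w) + occurrences x (y ∷ [])
    ≡⟨ cong (_+ occurrences x (y ∷ [])) (occurrences-reverse x w) ⟩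
  occurrences x w + occurrences x (y ∷ [])        ≡⟨ +-comm (occurrences x w) _ ⟩
  occurrences x (y ∷ []) + occurrences x w        ≡⟨ occurrences-++ x (y ∷ []) w ⟨
  occurrences x (y ∷ w)                           ∎
  where open ≡-Reasoning

three-reverse : ∀ {P} → All LengthThree P → All LengthThree (map reverse P)
three-reverse []                         = []
three-reverse ((a , b , c , refl) ∷ three) = (c , b , a , refl) ∷ three-reverse three

av-reverse : ∀ {P} → All LengthThree P → ∀ S → av S P ≡ av S (map reverse P)
av-reverse {P} three S = ≤-antisym
  (av-≤ three (three-reverse three) S S reverse reverse content (λ w _ → avoids⁺ three w))
  (av-≤ (three-reverse three) three S S reverse reverse content (λ w _ → avoids⁻ three w))
  where
  content : ∀ w → HasContent (Multiset.mult S) w →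
            HasContent (Multiset.mult S) (reverse w) × reverse (reverse w) ≡ w
  content w (<k , occ) =
    ( ↭ₚ.All-resp-↭ (↭-sym (↭ₚ.↭-reverse w)) <k
    , λ i → trans (occurrences-reverse (toℕ i) w) (occ i)) , reverse-involutive w
  avoids⁺ : ∀ {P} → All LengthThree P → ∀ w → All (Avoids w) P →
            All (Avoids (reverse w)) (map reverse P)
  avoids⁺ []                           w []         = []
  avoids⁺ ((a , b , c , refl) ∷ three) w (av ∷ avs) =
    avoids-transfer w (reverse w) (subst (Occurs (Pattern a b c)) (reverse-involutive w)
      ∘ occurs-reverse c b a) av ∷ avoids⁺ three w avs
  avoids⁻ : ∀ {P} → All LengthThree P → ∀ w → All (Avoids w) (map reverse P) →
            All (Avoids (reverse w)) P
  avoids⁻ []                           w []         = []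
  avoids⁻ ((a , b , c , refl) ∷ three) w (av ∷ avs) =
    avoids-transfer w (reverse w) (subst (Occurs (Pattern c b a)) (reverse-involutive w)
      ∘ occurs-reverse a b c) av ∷ avoids⁻ three w avs

opposites : Multiset → Multiset
opposites S = multiset size size≥1 (Vec.tabulate (Vec.lookup mult ∘ opposite))
  (Vecᴬₚ.tabulate⁺ (λ i → Vecᴬₚ.lookup⁺ mult≥1 (opposite i)))
  where open Multiset S

occurrences-∸ : ∀ {k x} → x < k → ∀ w → All (_< k) w →
  occurrences x (map (pred k ∸_) w) ≡ occurrences (pred k ∸ x) w
occurrences-∸ x< [] [] = refl
occurrences-∸ {suc k} {x} x< (y ∷ w) (y< ∷ <k) with x ≟ k ∸ y
... | yes x≡ = begin
  occurrences x (k ∸ y ∷ map (k ∸_) w)   ≡⟨ cong length (filter-accept (x ≟_) x≡) ⟩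
  suc (occurrences x (map (k ∸_) w))     ≡⟨ cong suc (occurrences-∸ x< w <k) ⟩
  suc (occurrences (k ∸ x) w)            ≡⟨ cong length (filter-accept (k ∸ x ≟_)
    (trans (cong (k ∸_) x≡) (m∸[m∸n]≡n (s≤s⁻¹ y<)))) ⟨
  occurrences (k ∸ x) (y ∷ w)            ∎
  where open ≡-Reasoning
... | no x≢ = begin
  occurrences x (k ∸ y ∷ map (k ∸_) w)   ≡⟨ cong length (filter-reject (x ≟_) x≢) ⟩
  occurrences x (map (k ∸_) w)           ≡⟨ occurrences-∸ x< w <k ⟩
  occurrences (k ∸ x) w                  ≡⟨ cong length (filter-reject (k ∸ x ≟_)
    (λ { refl → x≢ (sym (m∸[m∸n]≡n (s≤s⁻¹ x<))) })) ⟨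
  occurrences (k ∸ x) (y ∷ w)            ∎
  where open ≡-Reasoning

module _ {k : ℕ} (as as′ : Vec ℕ k)
         (opp : ∀ i → Vec.lookup as′ i ≡ Vec.lookup as (opposite i)) where

  content-complement : ∀ w → HasContent as w →
    HasContent as′ (map (pred k ∸_) w) × map (pred k ∸_) (map (pred k ∸_) w) ≡ w
  content-complement w (<k , occ) = (below w <k , occ′) , involutive w <k
    where
    below : ∀ {k} w → All (_< k) w → All (_< k) (map (pred k ∸_) w)
    below         []      []       = []
    below {suc k} (x ∷ w) (x< ∷ <k) = s≤s (m∸n≤m k x) ∷ below w <k
    involutive : ∀ {k} w → All (_< k) w → map (pred k ∸_) (map (pred k ∸_) w) ≡ w
    involutive         []      []        = refl
    involutive {suc k} (x ∷ w) (x< ∷ <k) = cong₂ _∷_ (m∸[m∸n]≡n (s≤s⁻¹ x<)) (involutive w <k)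
    occ′ : ∀ i → occurrences (toℕ i) (map (pred k ∸_) w) ≡ Vec.lookup as′ i
    occ′ i = begin
      occurrences (toℕ i) (map (pred k ∸_) w)  ≡⟨ occurrences-∸ (toℕ<n i) w <k ⟩
      occurrences (pred k ∸ toℕ i) w  ≡⟨ cong (λ n → occurrences n w) (pred-∸ k (toℕ i)) ⟩
      occurrences (k ∸ suc (toℕ i)) w ≡⟨ cong (λ n → occurrences n w) (opposite-prop i) ⟨
      occurrences (toℕ (opposite i)) w         ≡⟨ occ (opposite i) ⟩
      Vec.lookup as (opposite i)               ≡⟨ opp i ⟨
      Vec.lookup as′ i                         ∎
      where
      open ≡-Reasoning
      pred-∸ : ∀ m n → pred m ∸ n ≡ m ∸ suc n
      pred-∸ zero    n = 0∸n≡0 n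
      pred-∸ (suc m) n = refl

three-complement : ∀ {P} → All LengthThree P → All LengthThree (map complement P)
three-complement []                           = []
three-complement ((a , b , c , refl) ∷ three) = (_ , _ , _ , refl) ∷ three-complement three

-- Complementing reverses the order of the multiplicities. A complemented equivalence at `S` thus
-- comes from the original one at `opposites S`; `_∼_` survives because it quantifies over all
-- multisets.
av-complement : ∀ {P} → All LengthThree P → ∀ S → av S (map complement P) ≡ av (opposites S) P
av-complement {P} three S = ≤-antisym
  (av-≤ (three-complement three) three S (opposites S) f f
    (content-complement as as′ lookup-as′)
    (λ w (<k , _) → avoids⁺ three w (All.map <⇒≤pred <k)))
  (av-≤ three (three-complement three) (opposites S) S f f
    (content-complement as′ as (λ i → sym (trans (lookup-as′ (opposite i))
      (cong (Vec.lookup as) (opposite-involutive i)))))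
    (λ w (<k , _) → avoids⁻ three w (All.map <⇒≤pred <k)))
  where
  open Multiset S renaming (mult to as)
  as′ = Multiset.mult (opposites S)
  k = pred size
  f : Word → Word
  f = map (k ∸_)
  lookup-as′ : ∀ i → Vec.lookup as′ i ≡ Vec.lookup as (opposite i)
  lookup-as′ = Vecₚ.lookup∘tabulate (Vec.lookup as ∘ opposite)
  bound : ∀ {x} ρ → x ∈ ρ → x ≤ suc (foldr _⊔_ 0 ρ)
  bound ρ (here {xs = xs} refl) = m≤n⇒m≤1+n (m≤m⊔n _ (foldr _⊔_ 0 xs))
  bound ρ (there {x = y} {xs} x∈) = ≤-trans (bound xs x∈) (s≤s (m≤n⊔m y (foldr _⊔_ 0 xs)))
  avoids⁺ : ∀ {P} → All LengthThree P → ∀ w → All (_≤ k) w →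
            All (Avoids w) (map complement P) → All (Avoids (f w)) P
  avoids⁺ []                           w ≤k []         = []
  avoids⁺ ((a , b , c , refl) ∷ three) w ≤k (av ∷ avs) =
    avoids-transfer w (f w) (occurs-complement a b c
      (bound ρ (here refl)) (bound ρ (there (here refl))) (bound ρ (there (there (here refl)))) ≤k)
      av ∷ avoids⁺ three w ≤k avs
    where ρ = a ∷ b ∷ c ∷ []
  avoids⁻ : ∀ {P} → All LengthThree P → ∀ w → All (_≤ k) w →
            All (Avoids w) P → All (Avoids (f w)) (map complement P)
  avoids⁻ []                           w ≤k []         = []
  avoids⁻ ((a , b , c , refl) ∷ three) w ≤k (av ∷ avs) =
    avoids-transfer w (f w) (subst (λ (a , b , c) → Occurs (Pattern a b c) w)
      (cong₂ _,_ (m∸[m∸n]≡n (bound ρ (here refl)))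
        (cong₂ _,_ (m∸[m∸n]≡n (bound ρ (there (here refl))))
                   (m∸[m∸n]≡n (bound ρ (there (there (here refl)))))))
      ∘ occurs-complement (m ∸ a) (m ∸ b) (m ∸ c) (m∸n≤m m a) (m∸n≤m m b) (m∸n≤m m c) ≤k)
      av ∷ avoids⁻ three w ≤k avs
    where
    ρ = a ∷ b ∷ c ∷ []
    m = suc (foldr _⊔_ 0 ρ)

-- Generating trees

-- An Iverson bracket times `n`. It turns filtering into a factor that can be moved through sums.
weight : ∀ {A : Set} → Dec A → ℕ → ℕ
weight A? n = if does A? then n else 0

weight-yes : ∀ {A : Set} (A? : Dec A) {n} → A → weight A? n ≡ n
weight-yes (yes _) _ = refl
weight-yes (no ¬a) a = contradiction a ¬a

weight-no : ∀ {A : Set} (A? : Dec A) {n} → ¬ A → weight A? n ≡ 0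
weight-no (yes a) ¬a = contradiction a ¬a
weight-no (no _)  _  = refl

weight-cong : ∀ {A B : Set} (A? : Dec A) (B? : Dec B) {m n} → A ⇔ B → (A → m ≡ n) →
              weight A? m ≡ weight B? n
weight-cong (yes a) B? A⇔B eq = trans (eq a) (sym (weight-yes B? (to A⇔B a)))
weight-cong (no ¬a) B? A⇔B eq = sym (weight-no B? (¬a ∘ from A⇔B))

sumOver : (Word → ℕ) → List Word → ℕ
sumOver h ws = sum (map h ws)

sumOver-cong : ∀ {h h′} ws → (∀ {w} → w ∈ ws → h w ≡ h′ w) → sumOver h ws ≡ sumOver h′ ws
sumOver-cong []       eq = refl
sumOver-cong (w ∷ ws) eq = cong₂ _+_ (eq (here refl)) (sumOver-cong ws (eq ∘ there))

sumOver-zero : ∀ {h} ws → (∀ {w} → w ∈ ws → h w ≡ 0) → sumOver h ws ≡ 0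
sumOver-zero []       eq = refl
sumOver-zero (w ∷ ws) eq = cong₂ _+_ (eq (here refl)) (sumOver-zero ws (eq ∘ there))

sumOver-++ : ∀ h vs ws → sumOver h (vs ++ ws) ≡ sumOver h vs + sumOver h ws
sumOver-++ h []       ws = refl
sumOver-++ h (v ∷ vs) ws =
  trans (cong (h v +_) (sumOver-++ h vs ws)) (sym (+-assoc (h v) _ _))

sumOver-map : ∀ h f ws → sumOver h (map f ws) ≡ sumOver (h ∘ f) ws
sumOver-map h f ws = cong sum (sym (map-∘ ws))

sumOver-concatMap : ∀ h (f : Word → List Word) ws →
                    sumOver h (concatMap f ws) ≡ sumOver (sumOver h ∘ f) ws
sumOver-concatMap h f []       = refl
sumOver-concatMap h f (w ∷ ws) = trans (sumOver-++ h (f w) (concatMap f ws))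
  (cong (sumOver h (f w) +_) (sumOver-concatMap h f ws))

length-filter≡sum : ∀ {A : Word → Set} (A? : Decidable A) ws →
                length (filter A? ws) ≡ sumOver (λ w → weight (A? w) 1) ws
length-filter≡sum A? []       = refl
length-filter≡sum A? (w ∷ ws) with A? w
... | yes _ = cong suc (length-filter≡sum A? ws)
... | no  _ = length-filter≡sum A? ws

-- A generating tree for the words avoiding P: g stands for the sum over all
-- descendants at a fixed depth, as a function of the label, and Φ a g for the
-- sum over the children obtained by inserting suc a copies of a new least letter.
GrowthRule : Set
GrowthRule = ℕ → (ℕ → ℕ) → ℕ → ℕ

record GeneratedBy (Φ : GrowthRule) (P : List Word) : Set where
  field
    three    : All LengthThree P
    label    : Word → ℕ
    label-[] : label [] ≡ 1
    grow     : ∀ a g u →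
      sumOver (λ w → weight (avoidsAll? P w) (g (label w))) (shuffles (suc a) u) ≡
      weight (avoidsAll? P u) (Φ a g (label u))

-- The head of the vector belongs to the least letter, which is inserted last, so its rule is
-- applied to `g` first. `pred` matches the convention that `Φ a` inserts `suc a` copies.
iterate-rule : GrowthRule → ∀ {k} → Vec ℕ k → (ℕ → ℕ) → ℕ → ℕ
iterate-rule Φ []       g = g
iterate-rule Φ (a ∷ as) g = iterate-rule Φ as (Φ (pred a) g)

avoids-[] : ∀ {P} → All LengthThree P → All (Avoids []) P
avoids-[] []                           = []
avoids-[] ((a , b , c , refl) ∷ three) = (λ { (() ∷ _ , _) }) ∷ avoids-[] three

module _ {Φ : GrowthRule} {P : List Word} (G : GeneratedBy Φ P) where
  open GeneratedBy G

  -- The function `g` must vary: removing the least letter replaces `g` by `Φ a g`. The recursion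
  -- ends at the root, the empty word with its single site.
  sum-arrangements : ∀ {k} (as : Vec ℕ k) → Vecᴬ.All (1 ≤_) as → ∀ g →
    sumOver (λ w → weight (avoidsAll? P w) (g (label w))) (arrangements as) ≡
    iterate-rule Φ as g 1
  sum-arrangements [] Vecᴬ.[] g = begin
    weight (avoidsAll? P []) (g (label [])) + 0  ≡⟨ +-identityʳ _ ⟩
    weight (avoidsAll? P []) (g (label []))      ≡⟨ weight-yes (avoidsAll? P []) (avoids-[] three) ⟩
    g (label [])                                 ≡⟨ cong g label-[] ⟩
    g 1                                          ∎
    where open ≡-Reasoning
  sum-arrangements (suc a ∷ as) (_ Vecᴬ.∷ as≥1) g = begin
    sumOver h (concatMap (shuffles (suc a)) (arrangements as))
      ≡⟨ sumOver-concatMap h (shuffles (suc a)) (arrangements as) ⟩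
    sumOver (sumOver h ∘ shuffles (suc a)) (arrangements as)
      ≡⟨ sumOver-cong (arrangements as) (λ {u} _ → grow a g u) ⟩
    sumOver (λ u → weight (avoidsAll? P u) (Φ a g (label u))) (arrangements as)
      ≡⟨ sum-arrangements as as≥1 (Φ a g) ⟩
    iterate-rule Φ as (Φ a g) 1  ∎
    where
    open ≡-Reasoning
    h : Word → ℕ
    h w = weight (avoidsAll? P w) (g (label w))

  av≡iterate : ∀ S → av S P ≡ iterate-rule Φ (Multiset.mult S) (const 1) 1
  av≡iterate S = begin
    av S P                                                   ≡⟨ av≡arrangements three S ⟩
    length (filter (avoidsAll? P) (arrangements mult))       ≡⟨ length-filter≡sum (avoidsAll? P) (arrangements mult) ⟩
    sumOver (λ w → weight (avoidsAll? P w) 1) (arrangements mult) ≡⟨ sum-arrangements mult mult≥1 (const 1) ⟩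
    iterate-rule Φ mult (const 1) 1                          ∎
    where
    open ≡-Reasoning
    open Multiset S

generatedBy-∼ : ∀ {Φ P Q} → GeneratedBy Φ P → GeneratedBy Φ Q → P ∼ Q
generatedBy-∼ G H S = trans (av≡iterate G S) (sym (av≡iterate H S))

-- Sums over the shuffles of one word

Σsplits : (Word → Word → ℕ) → Word → ℕ
Σsplits h []      = h [] []
Σsplits h (x ∷ u) = h [] (x ∷ u) + Σsplits (h ∘ (x ∷_)) u

Σsplits-cong : ∀ {h h′} u → (∀ p q → p ++ q ≡ u → h p q ≡ h′ p q) → Σsplits h u ≡ Σsplits h′ u
Σsplits-cong []      eq = eq [] [] refl
Σsplits-cong (x ∷ u) eq = cong₂ _+_ (eq [] (x ∷ u) refl)
  (Σsplits-cong u (λ p q p++q → eq (x ∷ p) q (cong (x ∷_) p++q)))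

Σsplits-zero : ∀ u → Σsplits (λ _ _ → 0) u ≡ 0
Σsplits-zero []      = refl
Σsplits-zero (x ∷ u) = Σsplits-zero u

Σsplits-+ : ∀ h h′ u → Σsplits (λ p q → h p q + h′ p q) u ≡ Σsplits h u + Σsplits h′ u
Σsplits-+ h h′ []      = refl
Σsplits-+ h h′ (x ∷ u) = trans (cong (h [] (x ∷ u) + h′ [] (x ∷ u) +_) (Σsplits-+ (h ∘ (x ∷_)) (h′ ∘ (x ∷_)) u))
  (interchange +-commutativeSemigroup (h [] (x ∷ u)) _ _ _)

sum-shuffles-∷ : ∀ h a x u → sumOver h (shuffles (suc a) (x ∷ u)) ≡
  sumOver (h ∘ (0 ∷_)) (shuffles a (x ∷ u)) + sumOver (h ∘ (suc x ∷_)) (shuffles (suc a) u)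
sum-shuffles-∷ h a x u = trans
  (sumOver-++ h (map (0 ∷_) (shuffles a (x ∷ u))) (map (suc x ∷_) (shuffles (suc a) u)))
  (cong₂ _+_ (sumOver-map h (0 ∷_) (shuffles a (x ∷ u))) (sumOver-map h (suc x ∷_) (shuffles (suc a) u)))

-- The words that contain a 0 are those of the form lastZero v q.
lastZero : Word → Word → Word
lastZero v q = v ++ 0 ∷ map suc q

sum-shuffles-1 : ∀ h u → sumOver h (shuffles 1 u) ≡ Σsplits (λ p q → h (lastZero (map suc p) q)) u
sum-shuffles-1 h []      = +-identityʳ _
sum-shuffles-1 h (x ∷ u) = trans (sum-shuffles-∷ h 0 x u)
  (cong₂ _+_ (+-identityʳ _) (sum-shuffles-1 (h ∘ (suc x ∷_)) u))

zeros⊆shuffle : ∀ a u {w} → w ∈ shuffles a u → replicate a 0 ⊆ w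
zeros⊆shuffle zero    u       _  = minimum _
zeros⊆shuffle (suc a) []      w∈ with ∈-map⁻ (0 ∷_) w∈
... | v , v∈ , refl = refl ∷ zeros⊆shuffle a [] v∈
zeros⊆shuffle (suc a) (x ∷ u) w∈ with ∈-++⁻ (map (0 ∷_) (shuffles a (x ∷ u))) w∈
... | inj₁ w∈ˡ with ∈-map⁻ (0 ∷_) w∈ˡ
...   | v , v∈ , refl = refl ∷ zeros⊆shuffle a (x ∷ u) v∈
zeros⊆shuffle (suc a) (x ∷ u) w∈ | inj₂ w∈ʳ with ∈-map⁻ (suc x ∷_) w∈ʳ
...   | v , v∈ , refl = suc x ∷ʳ zeros⊆shuffle (suc a) u v∈

-- Two zeros with a positive letter between them make 121, where `h` vanishes. Only the shuffles
-- whose zeros form one block remain, one for each split of `u`.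
sum-shuffles-block : ∀ h → (∀ {y w} → 0 ∷ suc y ∷ 0 ∷ [] ⊆ w → h w ≡ 0) → ∀ a u →
  sumOver h (shuffles (suc a) u) ≡ Σsplits (λ p q → h (lastZero (map suc p ++ replicate a 0) q)) u
sum-shuffles-block h vanish a u = go h vanish a u
  where
  Vanishes : (Word → ℕ) → Set
  Vanishes h = ∀ {y w} → 0 ∷ suc y ∷ 0 ∷ [] ⊆ w → h w ≡ 0
  -- Once a 0 has been placed, a positive letter ahead of the remaining zeros would complete 0 y 0,
  -- so these zeros follow at once.
  initial : ∀ h → Vanishes h → ∀ a u →
    sumOver (h ∘ (0 ∷_)) (shuffles a u) ≡ h (lastZero (replicate a 0) u)
  initial h vanish zero    u       = +-identityʳ _
  initial h vanish (suc a) []      = trans (sumOver-map (h ∘ (0 ∷_)) (0 ∷_) (shuffles a []))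
    (initial (h ∘ (0 ∷_)) (vanish ∘ (0 ∷ʳ_)) a [])
  initial h vanish (suc a) (x ∷ u) = trans (sum-shuffles-∷ (h ∘ (0 ∷_)) a x u) (trans
    (cong₂ _+_ (initial (h ∘ (0 ∷_)) (vanish ∘ (0 ∷ʳ_)) a (x ∷ u))
      (sumOver-zero (shuffles (suc a) u) λ w∈ → vanish (refl ∷ refl ∷
        ⊆-trans (refl ∷ minimum _) (zeros⊆shuffle (suc a) u w∈))))
    (+-identityʳ _))
  go : ∀ h → Vanishes h → ∀ a u → sumOver h (shuffles (suc a) u) ≡
    Σsplits (λ p q → h (lastZero (map suc p ++ replicate a 0) q)) u
  go h vanish a []      = trans (sumOver-map h (0 ∷_) (shuffles a [])) (initial h vanish a [])
  go h vanish a (x ∷ u) = trans (sum-shuffles-∷ h a x u)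
    (cong₂ _+_ (initial h vanish a (x ∷ u)) (go (h ∘ (suc x ∷_)) (vanish ∘ (suc x ∷ʳ_)) a u))

-- A positive letter ahead of two zeros makes 211, where `h` vanishes. Hence zeros come first as
-- long as at least two are left, and only the last one is free.
sum-shuffles-front : ∀ h → (∀ {x w} → suc x ∷ 0 ∷ 0 ∷ [] ⊆ w → h w ≡ 0) → ∀ a u →
  sumOver h (shuffles (suc a) u) ≡ Σsplits (λ p q → h (lastZero (replicate a 0 ++ map suc p) q)) u
sum-shuffles-front h vanish zero    u       = sum-shuffles-1 h u
sum-shuffles-front h vanish (suc a) []      = trans (sumOver-map h (0 ∷_) (shuffles (suc a) []))
  (sum-shuffles-front (h ∘ (0 ∷_)) (vanish ∘ (0 ∷ʳ_)) a [])
sum-shuffles-front h vanish (suc a) (x ∷ u) = trans (sum-shuffles-∷ h (suc a) x u) (trans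
  (cong₂ _+_ (sum-shuffles-front (h ∘ (0 ∷_)) (vanish ∘ (0 ∷ʳ_)) a (x ∷ u))
    (sumOver-zero (shuffles (2 + a) u) λ w∈ → vanish (refl ∷
      ⊆-trans (refl ∷ refl ∷ minimum _) (zeros⊆shuffle (2 + a) u w∈))))
  (+-identityʳ _))

-- The outer split `v`, `r` places the second 0; the inner split of `v` places the first.
sum-shuffles-2 : ∀ h u → sumOver h (shuffles 2 u) ≡
  Σsplits (λ v r → Σsplits (λ p q → h (lastZero (lastZero (map suc p) q) r)) v) u
sum-shuffles-2 h []      = +-identityʳ _
sum-shuffles-2 h (x ∷ u) = begin
  sumOver h (shuffles 2 (x ∷ u))
    ≡⟨ sum-shuffles-∷ h 1 x u ⟩
  sumOver (h ∘ (0 ∷_)) (shuffles 1 (x ∷ u)) + sumOver (h ∘ (suc x ∷_)) (shuffles 2 u)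
    ≡⟨ cong₂ _+_ (sum-shuffles-1 (h ∘ (0 ∷_)) (x ∷ u)) (sum-shuffles-2 (h ∘ (suc x ∷_)) u) ⟩
  (first + Σsplits f u) + Σsplits f′ u       ≡⟨ +-assoc first _ _ ⟩
  first + (Σsplits f u + Σsplits f′ u)       ≡⟨ cong (first +_) (Σsplits-+ f f′ u) ⟨
  first + Σsplits (λ v r → f v r + f′ v r) u ∎
  where
  open ≡-Reasoning
  first : ℕ
  first = h (0 ∷ 0 ∷ map suc (x ∷ u))
  -- `f` is the inner split that puts the first 0 in front of everything, `f′` the sum of all other
  -- inner splits.
  f f′ : Word → Word → ℕ
  f  v r = h (0 ∷ lastZero (suc x ∷ map suc v) r)
  f′ v r = Σsplits (λ p q → h (suc x ∷ lastZero (lastZero (map suc p) q) r)) v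

-- Sublists and the deletion of the letter 0

Relation : Set₁
Relation = ℕ → ℕ → Set

lower-⊆ : ∀ {v w} → v ⊆ w → lower v ⊆ lower w
lower-⊆ []                        = []
lower-⊆ (zero  ∷ʳ τ)              = lower-⊆ τ
lower-⊆ (suc x ∷ʳ τ)              = x ∷ʳ lower-⊆ τ
lower-⊆ (_∷_ {zero}  refl τ)      = lower-⊆ τ
lower-⊆ (_∷_ {suc x} refl τ)      = refl ∷ lower-⊆ τ

map-suc-lower-⊆ : ∀ w → map suc (lower w) ⊆ w
map-suc-lower-⊆ []          = []
map-suc-lower-⊆ (zero  ∷ w) = 0 ∷ʳ map-suc-lower-⊆ w
map-suc-lower-⊆ (suc x ∷ w) = refl ∷ map-suc-lower-⊆ w

occurs-lower : ∀ a b c {w} → Occurs (Pattern a b c) (lower w) → Occurs (Pattern a b c) w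
occurs-lower a b c {w} (x , y , z , τ , p) =
  suc x , suc y , suc z , ⊆-trans (⊆ₚ.map⁺ suc τ) (map-suc-lower-⊆ w) , pattern-suc a b c {x} {y} {z} p

lower-zeros : ∀ a w → lower (replicate a 0 ++ w) ≡ lower w
lower-zeros zero    w = refl
lower-zeros (suc a) w = lower-zeros a w

lower-lastZero : ∀ v q → lower (lastZero v q) ≡ lower v ++ q
lower-lastZero v q = trans (lower-++ v _) (cong (lower v ++_) (lower-map-suc q))

lower-block : ∀ a p → lower (map suc p ++ replicate a 0) ≡ p
lower-block a p = begin
  lower (map suc p ++ replicate a 0)           ≡⟨ lower-++ (map suc p) (replicate a 0) ⟩
  lower (map suc p) ++ lower (replicate a 0)   ≡⟨ cong₂ _++_ (lower-map-suc p) (lower-replicate a) ⟩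
  p ++ []                                      ≡⟨ ++-identityʳ p ⟩
  p                                            ∎
  where
  open ≡-Reasoning
  lower-replicate : ∀ a → lower (replicate a 0) ≡ []
  lower-replicate zero    = refl
  lower-replicate (suc a) = lower-replicate a

lower-front : ∀ a p → lower (replicate a 0 ++ map suc p) ≡ p
lower-front a p = trans (lower-zeros a (map suc p)) (lower-map-suc p)

drop-zeros : ∀ {x σ} a {w} → suc x ∷ σ ⊆ replicate a 0 ++ w → suc x ∷ σ ⊆ w
drop-zeros zero    τ        = τ
drop-zeros (suc a) (_ ∷ʳ τ) = drop-zeros a τ

drop-positives : ∀ {σ} p {w} → 0 ∷ σ ⊆ map suc p ++ w → 0 ∷ σ ⊆ w
drop-positives []      τ        = τ
drop-positives (x ∷ p) (_ ∷ʳ τ) = drop-positives p τ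

tail-⊆ : ∀ {x σ} {w : Word} → x ∷ σ ⊆ w → σ ⊆ w
tail-⊆ = ⊆-trans (_ ∷ʳ ⊆-refl)

0⊈map-suc : ∀ {σ} q → ¬ (0 ∷ σ ⊆ map suc q)
0⊈map-suc (x ∷ q) (_ ∷ʳ τ) = 0⊈map-suc q τ

∈-before-lastZero : ∀ {x σ} v q → suc x ∷ 0 ∷ σ ⊆ lastZero v q → suc x ∈ v
∈-before-lastZero []      q (_ ∷ʳ τ)   = contradiction (tail-⊆ τ) (0⊈map-suc q)
∈-before-lastZero (_ ∷ v) q (_ ∷ʳ τ)   = there (∈-before-lastZero v q τ)
∈-before-lastZero (_ ∷ v) q (refl ∷ τ) = here refl

⊆-before-lastZero : ∀ {x y} v q → suc x ∷ suc y ∷ 0 ∷ [] ⊆ lastZero v q → suc x ∷ suc y ∷ [] ⊆ v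
⊆-before-lastZero []      q (_ ∷ʳ τ)   = contradiction (tail-⊆ (tail-⊆ τ)) (0⊈map-suc q)
⊆-before-lastZero (_ ∷ v) q (_ ∷ʳ τ)   = _ ∷ʳ ⊆-before-lastZero v q τ
⊆-before-lastZero (_ ∷ v) q (refl ∷ τ) = refl ∷ from∈ (∈-before-lastZero v q τ)

∈-lower⁺ : ∀ {x} w → suc x ∈ w → x ∈ lower w
∈-lower⁺ (suc x ∷ w) (here refl) = here refl
∈-lower⁺ (zero  ∷ w) (there x∈)  = ∈-lower⁺ w x∈
∈-lower⁺ (suc y ∷ w) (there x∈)  = there (∈-lower⁺ w x∈)

∈-lower⁻ : ∀ {x} w → x ∈ lower w → suc x ∈ w
∈-lower⁻ (zero  ∷ w) x∈          = there (∈-lower⁻ w x∈)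
∈-lower⁻ (suc y ∷ w) (here refl) = here refl
∈-lower⁻ (suc y ∷ w) (there x∈)  = there (∈-lower⁻ w x∈)

-- Occurrences involving the least letter

record ZeroOccurrences (a b c : ℕ) (Zero : Word → Set) : Set where
  field
    zero⇒occurs : ∀ {w} → Zero w → Occurs (Pattern a b c) w
    occurs⇒zero : ∀ {w} → Occurs (Pattern a b c) w → Occurs (Pattern a b c) (lower w) ⊎ Zero w

open ZeroOccurrences

-- As 0 is the least letter, in an occurrence it can only play the role of the 1s of the pattern;
-- these are the resulting shapes.
Zero₁₁₁ Zero₁₂₁ Zero₂₁₁ : Word → Set
Zero₁₁₁ w = 0 ∷ 0 ∷ 0 ∷ [] ⊆ w
Zero₁₂₁ w = ∃ λ y → 0 ∷ suc y ∷ 0 ∷ [] ⊆ w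
Zero₂₁₁ w = ∃ λ x → suc x ∷ 0 ∷ 0 ∷ [] ⊆ w

-- With (a , b) equal to (1 , 0), (0 , 1), (0 , 0), `ZeroLast` serves 321, 231, 221. `ZeroMiddle`
-- serves 312 at (1 , 0) and 212 at (0 , 0).
ZeroLast ZeroMiddle : (a b : ℕ) → Word → Set
ZeroLast   a b w = ∃₂ λ x y → suc x ∷ suc y ∷ 0 ∷ [] ⊆ w × Like a b x y
ZeroMiddle a b w = ∃₂ λ x z → suc x ∷ 0 ∷ suc z ∷ [] ⊆ w × Like a b x z

zero₁₁₁ : ZeroOccurrences 1 1 1 Zero₁₁₁
zero₁₁₁ .zero⇒occurs τ = 0 , 0 , 0 , τ , refl , refl , refl
zero₁₁₁ .occurs⇒zero (zero  , _ , _ , τ , refl , refl , refl) = inj₂ τ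
zero₁₁₁ .occurs⇒zero (suc x , _ , _ , τ , refl , refl , refl) =
  inj₁ (x , x , x , lower-⊆ τ , refl , refl , refl)

zero₁₂₁ : ZeroOccurrences 1 2 1 Zero₁₂₁
zero₁₂₁ .zero⇒occurs (y , τ) = 0 , suc y , 0 , τ , z<s , z<s , refl
zero₁₂₁ .occurs⇒zero (zero  , suc y , _ , τ , _   , _   , refl) = inj₂ (y , τ)
zero₁₂₁ .occurs⇒zero (suc x , suc y , _ , τ , x<y , y>z , refl) =
  inj₁ (x , y , x , lower-⊆ τ , s<s⁻¹ x<y , s<s⁻¹ y>z , refl)

zero₂₁₁ : ZeroOccurrences 2 1 1 Zero₂₁₁
zero₂₁₁ .zero⇒occurs (x , τ) = suc x , 0 , 0 , τ , z<s , refl , z<s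
zero₂₁₁ .occurs⇒zero (suc x , zero  , _ , τ , _   , refl , _)   = inj₂ (x , τ)
zero₂₁₁ .occurs⇒zero (suc x , suc y , _ , τ , x>y , refl , x>z) =
  inj₁ (x , y , y , lower-⊆ τ , s<s⁻¹ x>y , refl , s<s⁻¹ x>z)

zeroLast : ∀ a b → ZeroOccurrences (2 + a) (2 + b) 1 (ZeroLast a b)
zeroLast a b .zero⇒occurs (x , y , τ , xy) =
  suc x , suc y , 0 , τ , like-suc a b xy , z<s , z<s
zeroLast a b .occurs⇒zero (suc x , suc y , zero  , τ , xy , _ , _) =
  inj₂ (x , y , τ , like-pred a b xy)
zeroLast a b .occurs⇒zero (suc x , suc y , suc z , τ , xy , y>z , x>z) =
  inj₁ (x , y , z , lower-⊆ τ , like-pred a b xy , s<s⁻¹ y>z , s<s⁻¹ x>z)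

zeroMiddle : ∀ a b → ZeroOccurrences (2 + a) 1 (2 + b) (ZeroMiddle a b)
zeroMiddle a b .zero⇒occurs (x , z , τ , xz) =
  suc x , 0 , suc z , τ , z<s , z<s , like-suc a b xz
zeroMiddle a b .occurs⇒zero (suc x , zero  , suc z , τ , _ , _ , xz) =
  inj₂ (x , z , τ , like-pred a b xz)
zeroMiddle a b .occurs⇒zero (suc x , suc y , suc z , τ , x>y , y<z , xz) =
  inj₁ (x , y , z , lower-⊆ τ , s<s⁻¹ x>y , s<s⁻¹ y<z , like-pred a b xz)

module _ {a b c d e f : ℕ} {Zero Zero′ : Word → Set}
         (Z : ZeroOccurrences a b c Zero) (Z′ : ZeroOccurrences d e f Zero′) where

  private
    P : List Word
    P = (a ∷ b ∷ c ∷ []) ∷ (d ∷ e ∷ f ∷ []) ∷ []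

  -- With its converse `avoids-lower⁺`, this reduces avoidance after an insertion to avoidance
  -- before it and the absence of occurrences through 0. Sites only have to express the latter.
  avoids-lower⁻ : ∀ w → All (Avoids w) P → All (Avoids (lower w)) P × ¬ Zero w × ¬ Zero′ w
  avoids-lower⁻ w (av ∷ av′ ∷ []) =
    avoids-transfer w (lower w) (occurs-lower a b c) av ∷
    avoids-transfer w (lower w) (occurs-lower d e f) av′ ∷ [] ,
    av ∘ occurs⇒contains w ∘ zero⇒occurs Z , av′ ∘ occurs⇒contains w ∘ zero⇒occurs Z′

  avoids-lower⁺ : ∀ w → All (Avoids (lower w)) P → ¬ Zero w → ¬ Zero′ w → All (Avoids w) P
  avoids-lower⁺ w (av ∷ av′ ∷ []) ¬z ¬z′ = step Z av ¬z ∷ step Z′ av′ ¬z′ ∷ []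
    where
    step : ∀ {a b c Zero} → ZeroOccurrences a b c Zero →
           Avoids (lower w) (a ∷ b ∷ c ∷ []) → ¬ Zero w → Avoids w (a ∷ b ∷ c ∷ [])
    step Z av ¬z con =
      [ av ∘ occurs⇒contains (lower w) , ¬z ]′ (occurs⇒zero Z (contains⇒occurs w con))

HasPair : (a b : ℕ) → Word → Set
HasPair a b p = ∃₂ λ x y → x ∷ y ∷ [] ⊆ p × Like a b x y

Crosses : (a b : ℕ) → Word → Word → Set
Crosses a b p q = ∃₂ λ x z → x ∈ p × z ∈ q × Like a b x z

zeroLast⁻ : ∀ a b v q → ZeroLast a b (lastZero v q) → HasPair a b (lower v)
zeroLast⁻ a b v q (x , y , τ , xy) = x , y , lower-⊆ (⊆-before-lastZero v q τ) , xy

zeroLast⁺ : ∀ a b v q → HasPair a b (lower v) → ZeroLast a b (lastZero v q)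
zeroLast⁺ a b v q (x , y , τ , xy) =
  x , y , ⊆ₚ.++⁺ (⊆-trans (⊆ₚ.map⁺ suc τ) (map-suc-lower-⊆ v)) (refl ∷ minimum _) , xy

zeroMiddle⁺ : ∀ a b v q → Crosses a b (lower v) q → ZeroMiddle a b (lastZero v q)
zeroMiddle⁺ a b v q (x , z , x∈ , z∈ , xz) =
  x , z , ⊆ₚ.++⁺ (from∈ (∈-lower⁻ v x∈)) (refl ∷ from∈ (∈-map⁺ suc z∈)) , xz

private
  assoc : ∀ {σ} (u v w : Word) → σ ⊆ (u ++ v) ++ w → σ ⊆ u ++ (v ++ w)
  assoc u v w = subst (_ ⊆_) (++-assoc u v w)

-- Whichever 0 of the block is the middle letter, the positive letters before it are those of `p`
-- and those after it are those of `q`.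
zeroMiddle-block⁻ : ∀ n a b p q → ZeroMiddle a b (lastZero (map suc p ++ replicate n 0) q) →
                    Crosses a b p q
zeroMiddle-block⁻ n a b p q (x , z , τ , xz) = x , z ,
  subst (x ∈_) (lower-block n p) (∈-lower⁺ (map suc p ++ replicate n 0)
    (∈-before-lastZero (map suc p ++ replicate n 0) q τ)) ,
  to∈ (subst (_ ⊆_) (trans (lower-zeros n (0 ∷ map suc q)) (lower-map-suc q))
    (lower-⊆ (drop-positives p (tail-⊆ (assoc (map suc p) (replicate n 0) _ τ))))) , xz

-- The zeros at the front have no positive letter before them, so the middle letter can only be the
-- last 0.
zeroMiddle-front⁻ : ∀ n a b p q → ZeroMiddle a b (lastZero (replicate n 0 ++ map suc p) q) →
                    Crosses a b p q
zeroMiddle-front⁻ n a b p q (x , z , τ , xz) = x , z ,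
  subst (x ∈_) (lower-front n p) (∈-lower⁺ (replicate n 0 ++ map suc p)
    (∈-before-lastZero (replicate n 0 ++ map suc p) q τ)) ,
  to∈ (subst (_ ⊆_) (lower-map-suc q)
    (lower-⊆ (drop-positives p (tail-⊆ (drop-zeros n (assoc (replicate n 0) (map suc p) _ τ)))))) , xz

¬zero₁₂₁-block : ∀ n p q → ¬ Zero₁₂₁ (lastZero (map suc p ++ replicate n 0) q)
¬zero₁₂₁-block n p q (y , τ)
  with drop-zeros n (tail-⊆ (drop-positives p (assoc (map suc p) (replicate n 0) _ τ)))
... | _ ∷ʳ τ′ = 0⊈map-suc q (tail-⊆ τ′)

00⊈lastZero : ∀ {σ} p q → ¬ (0 ∷ 0 ∷ σ ⊆ lastZero (map suc p) q)
00⊈lastZero p q τ with drop-positives p τ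
... | _ ∷ʳ τ′   = 0⊈map-suc q τ′
... | refl ∷ τ′ = 0⊈map-suc q τ′

¬zero₂₁₁-front : ∀ n p q → ¬ Zero₂₁₁ (lastZero (replicate n 0 ++ map suc p) q)
¬zero₂₁₁-front n p q (x , τ) =
  00⊈lastZero p q (tail-⊆ (drop-zeros n (assoc (replicate n 0) (map suc p) _ τ)))

¬zero₁₁₁-1 : ∀ p q → ¬ Zero₁₁₁ (lastZero (map suc p) q)
¬zero₁₁₁-1 p q = 00⊈lastZero p q

¬zero₁₁₁-2 : ∀ p q r → ¬ Zero₁₁₁ (lastZero (lastZero (map suc p) q) r)
¬zero₁₁₁-2 p q r τ with drop-positives p (assoc (map suc p) (0 ∷ map suc q) _ τ)
... | _ ∷ʳ τ′   = 00⊈lastZero q r (tail-⊆ τ′)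
... | refl ∷ τ′ = 00⊈lastZero q r τ′

-- Active sites and their number

-- s p q means that the site between p and q in the word p ++ q is active: a new
-- least letter may be inserted there.
Site : Set₁
Site = Word → Word → Set

Decidableˢ : Site → Set
Decidableˢ s = ∀ p q → Dec (s p q)

count : {s : Site} → Decidableˢ s → Word → ℕ
count s? []      = weight (s? [] []) 1
count s? (x ∷ u) = weight (s? [] (x ∷ u)) 1 + count (λ p → s? (x ∷ p)) u

-- The site between `p` and `q` itself is not counted here; it belongs to `countAfter`.
countBefore : {s : Site} → Decidableˢ s → Word → Word → ℕ
countBefore s? []      q = 0
countBefore s? (x ∷ p) q = weight (s? [] (x ∷ p ++ q)) 1 + countBefore (λ p → s? (x ∷ p)) p q

countAfter : {s : Site} → Decidableˢ s → Word → Word → ℕ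
countAfter s? p q = count (λ p′ → s? (p ++ p′)) q

count-++ : ∀ {s : Site} (s? : Decidableˢ s) p q →
           count s? (p ++ q) ≡ countBefore s? p q + countAfter s? p q
count-++ s? []      q = refl
count-++ s? (x ∷ p) q = trans (cong (weight (s? [] (x ∷ p ++ q)) 1 +_) (count-++ (λ p → s? (x ∷ p)) p q))
  (sym (+-assoc (weight (s? [] (x ∷ p ++ q)) 1) _ _))

count-cong : ∀ {s t : Site} (s? : Decidableˢ s) (t? : Decidableˢ t) u →
             (∀ p q → s p q ⇔ t p q) → count s? u ≡ count t? u
count-cong s? t? []      s⇔t = weight-cong (s? [] []) (t? [] []) (s⇔t [] []) (λ _ → refl)
count-cong s? t? (x ∷ u) s⇔t = cong₂ _+_
  (weight-cong (s? [] (x ∷ u)) (t? [] (x ∷ u)) (s⇔t [] (x ∷ u)) (λ _ → refl))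
  (count-cong _ _ u (s⇔t ∘ (x ∷_)))

count-map-suc : ∀ {s t : Site} (s? : Decidableˢ s) (t? : Decidableˢ t) u →
  (∀ p q → s (map suc p) (map suc q) ⇔ t p q) → count s? (map suc u) ≡ count t? u
count-map-suc s? t? []      s⇔t = weight-cong (s? [] []) (t? [] []) (s⇔t [] []) (λ _ → refl)
count-map-suc s? t? (x ∷ u) s⇔t = cong₂ _+_
  (weight-cong (s? [] (suc x ∷ map suc u)) (t? [] (x ∷ u)) (s⇔t [] (x ∷ u)) (λ _ → refl))
  (count-map-suc _ _ u (s⇔t ∘ (x ∷_)))

countBefore-map-suc : ∀ {s t : Site} (s? : Decidableˢ s) (t? : Decidableˢ t) p w q →
  (∀ p₁ p₂ → s (map suc p₁) (map suc p₂ ++ w) ⇔ t p₁ (p₂ ++ q)) →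
  countBefore s? (map suc p) w ≡ countBefore t? p q
countBefore-map-suc s? t? []      w q s⇔t = refl
countBefore-map-suc s? t? (x ∷ p) w q s⇔t = cong₂ _+_
  (weight-cong (s? [] _) (t? [] _) (s⇔t [] (x ∷ p)) (λ _ → refl))
  (countBefore-map-suc _ _ p w q (s⇔t ∘ (x ∷_)))

count-none : ∀ {s : Site} (s? : Decidableˢ s) u → (∀ p q → ¬ s p q) → count s? u ≡ 0
count-none s? []      ¬s = weight-no (s? [] []) (¬s [] [])
count-none s? (x ∷ u) ¬s =
  cong₂ _+_ (weight-no (s? [] (x ∷ u)) (¬s [] (x ∷ u))) (count-none _ u (¬s ∘ (x ∷_)))

countBefore-none : ∀ {s : Site} (s? : Decidableˢ s) p q → (∀ p₁ p₂ → ¬ s p₁ (p₂ ++ q)) →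
                   countBefore s? p q ≡ 0
countBefore-none s? []      q ¬s = refl
countBefore-none s? (x ∷ p) q ¬s =
  cong₂ _+_ (weight-no (s? [] _) (¬s [] (x ∷ p))) (countBefore-none _ p q (¬s ∘ (x ∷_)))

countBefore-all : ∀ {s : Site} (s? : Decidableˢ s) p q →
  (∀ p₁ p₂ → p₁ ++ p₂ ≡ p → s p₁ (p₂ ++ q)) → countBefore s? p q ≡ length p
countBefore-all s? []      q all-s = refl
countBefore-all s? (x ∷ p) q all-s = cong₂ _+_ (weight-yes (s? [] _) (all-s [] (x ∷ p) refl))
  (countBefore-all _ p q (λ p₁ p₂ eq → all-s (x ∷ p₁) p₂ (cong (x ∷_) eq)))

Σ< : ℕ → (ℕ → ℕ) → ℕ
Σ< zero    g = 0
Σ< (suc n) g = g n + Σ< n g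

Σ<-suc : ∀ n g → Σ< (suc n) g ≡ g 0 + Σ< n (g ∘ suc)
Σ<-suc zero    g = refl
Σ<-suc (suc n) g = begin
  g (suc n) + Σ< (suc n) g              ≡⟨ cong (g (suc n) +_) (Σ<-suc n g) ⟩
  g (suc n) + (g 0 + Σ< n (g ∘ suc))    ≡⟨ +-assoc (g (suc n)) _ _ ⟨
  g (suc n) + g 0 + Σ< n (g ∘ suc)      ≡⟨ cong (_+ Σ< n (g ∘ suc)) (+-comm (g (suc n)) (g 0)) ⟩
  g 0 + g (suc n) + Σ< n (g ∘ suc)      ≡⟨ +-assoc (g 0) _ _ ⟩
  g 0 + Σ< (suc n) (g ∘ suc)            ∎
  where open ≡-Reasoning

Σ<-+ : ∀ n g h → Σ< n (λ i → g i + h i) ≡ Σ< n g + Σ< n h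
Σ<-+ zero    g h = refl
Σ<-+ (suc n) g h = trans (cong (g n + h n +_) (Σ<-+ n g h)) (interchange +-commutativeSemigroup (g n) (h n) _ _)

-- Read from left to right, the active sites have 0, 1, 2, ... active sites before them. This is why
-- the labels of the children depend on the number of active sites alone.
Σsplits-before : ∀ {s : Site} (s? : Decidableˢ s) g u →
  Σsplits (λ p q → weight (s? p q) (g (countBefore s? p q))) u ≡ Σ< (count s? u) g
Σsplits-before s? g [] with s? [] []
... | yes _ = sym (+-identityʳ (g 0))
... | no  _ = refl
Σsplits-before s? g (x ∷ u) = trans
  (cong (weight (s? [] (x ∷ u)) (g 0) +_) (trans
    -- The site in front of `x` has the right part `x ∷ p ++ q`; rewriting it to `x ∷ u` makes its
    -- weight the same for all splits.
    (Σsplits-cong u (λ p q eq → cong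
      (λ v → weight (s? (x ∷ p) q)
               (g (weight (s? [] (x ∷ v)) 1 + countBefore (λ p → s? (x ∷ p)) p q))) eq))
    (Σsplits-before (λ p → s? (x ∷ p)) (g ∘ (weight (s? [] (x ∷ u)) 1 +_)) u)))
  assemble
  where
  c = count (λ p → s? (x ∷ p)) u
  assemble : weight (s? [] (x ∷ u)) (g 0) + Σ< c (g ∘ (weight (s? [] (x ∷ u)) 1 +_)) ≡
             Σ< (weight (s? [] (x ∷ u)) 1 + c) g
  assemble with s? [] (x ∷ u)
  ... | yes _ = sym (Σ<-suc c g)
  ... | no  _ = refl

-- `countAfter` includes the chosen site, so its values at active sites run from the total number
-- down to 1; hence the `suc`.
Σsplits-after : ∀ {s : Site} (s? : Decidableˢ s) g u →
  Σsplits (λ p q → weight (s? p q) (g (countAfter s? p q))) u ≡ Σ< (count s? u) (g ∘ suc)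
Σsplits-after s? g [] with s? [] []
... | yes _ = sym (+-identityʳ (g 1))
... | no  _ = refl
Σsplits-after s? g (x ∷ u) = trans
  (cong (weight (s? [] (x ∷ u)) (g (count s? (x ∷ u))) +_) (Σsplits-after (λ p → s? (x ∷ p)) g u))
  assemble
  where
  c = count (λ p → s? (x ∷ p)) u
  assemble : weight (s? [] (x ∷ u)) (g (weight (s? [] (x ∷ u)) 1 + c)) + Σ< c (g ∘ suc) ≡
             Σ< (weight (s? [] (x ∷ u)) 1 + c) (g ∘ suc)
  assemble with s? [] (x ∷ u)
  ... | yes _ = refl
  ... | no  _ = refl

somePair? : ∀ {R : Relation} → (∀ x y → Dec (R x y)) → ∀ p →
            Dec (∃₂ λ x y → x ∷ y ∷ [] ⊆ p × R x y)
somePair?         R? []      = no λ { (_ , _ , () , _) }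
somePair? {R = R} R? (x ∷ p) = map′ ⇒ ⇐ (Any.any? (R? x) p ⊎-dec somePair? R? p)
  where
  ⇒ : Any (R x) p ⊎ (∃₂ λ y z → y ∷ z ∷ [] ⊆ p × R y z) → ∃₂ λ y z → y ∷ z ∷ [] ⊆ x ∷ p × R y z
  ⇒ (inj₁ any) with find any
  ... | y , y∈ , xy = x , y , refl ∷ from∈ y∈ , xy
  ⇒ (inj₂ (y , z , τ , yz)) = y , z , x ∷ʳ τ , yz
  ⇐ : (∃₂ λ y z → y ∷ z ∷ [] ⊆ x ∷ p × R y z) → Any (R x) p ⊎ (∃₂ λ y z → y ∷ z ∷ [] ⊆ p × R y z)
  ⇐ (y , z , _ ∷ʳ τ   , yz) = inj₂ (y , z , τ , yz)
  ⇐ (y , z , refl ∷ τ , yz) = inj₁ (lose (to∈ τ) yz)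

hasPair? : ∀ a b → Decidable (HasPair a b)
hasPair? a b = somePair? (like? a b)

crosses? : ∀ a b p q → Dec (Crosses a b p q)
crosses? a b p q = map′ ⇒ ⇐ (Any.any? (λ x → Any.any? (like? a b x) q) p)
  where
  ⇒ : Any (λ x → Any (Like a b x) q) p → Crosses a b p q
  ⇒ any with find any
  ... | x , x∈ , any′ with find any′
  ...   | z , z∈ , xz = x , z , x∈ , z∈ , xz
  ⇐ : Crosses a b p q → Any (λ x → Any (Like a b x) q) p
  ⇐ (x , z , x∈ , z∈ , xz) = lose x∈ (lose z∈ xz)

-- The sites for patterns that end in their least letter (321, 231, 221) and for
-- those that have it in the middle (312, 212).
noPair? : ∀ a b → Decidableˢ (λ p _ → ¬ HasPair a b p)
noPair? a b p _ = ¬? (hasPair? a b p)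

noCross? : ∀ a b → Decidableˢ (λ p q → ¬ Crosses a b p q)
noCross? a b p q = ¬? (crosses? a b p q)

contraposition⇔ : ∀ {A B : Set} → (A → B) → (B → A) → (¬ A) ⇔ (¬ B)
contraposition⇔ f g = mk⇔ (_∘ g) (_∘ f)

module _ {a b : ℕ} where

  hasPair-⊆ : ∀ {p q} → p ⊆ q → HasPair a b p → HasPair a b q
  hasPair-⊆ τ (x , y , σ , xy) = x , y , ⊆-trans σ τ , xy

  hasPair-++ : ∀ {x y} p q → Like a b x y → HasPair a b (p ++ x ∷ y ∷ q)
  hasPair-++ p q xy = _ , _ , ⊆ₚ.++⁺ˡ p (refl ∷ refl ∷ minimum q) , xy

  hasPair-lower⁺ : ∀ w → HasPair a b (lower w) → HasPair a b w
  hasPair-lower⁺ w (x , y , τ , xy) =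
    suc x , suc y , ⊆-trans (⊆ₚ.map⁺ suc τ) (map-suc-lower-⊆ w) , like-suc a b xy

  hasPair-map-suc⁻ : ∀ p → HasPair a b (map suc p) → HasPair a b p
  hasPair-map-suc⁻ p (zero  , _     , τ , _)  = contradiction τ (0⊈map-suc p)
  hasPair-map-suc⁻ p (suc x , zero  , τ , _)  = contradiction (tail-⊆ τ) (0⊈map-suc p)
  hasPair-map-suc⁻ p (suc x , suc y , τ , xy) =
    x , y , subst (_ ⊆_) (lower-map-suc p) (lower-⊆ τ) , like-pred a b xy

  noPair-map-suc : ∀ p → (¬ HasPair a b (map suc p)) ⇔ (¬ HasPair a b p)
  noPair-map-suc p = contraposition⇔ (hasPair-map-suc⁻ p)
    (hasPair-lower⁺ (map suc p) ∘ subst (HasPair a b) (sym (lower-map-suc p)))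

  -- Every prefix of `v` is free of pairs too, so all `length v + 1` sites up to the one just before
  -- 0 are active.
  count-noPair-0 : ∀ v w → ¬ HasPair a b v → count (noPair? a b) (v ++ 0 ∷ w) ≡
    length v + suc (count {λ p _ → ¬ HasPair a b (v ++ 0 ∷ p)} (λ p → noPair? a b (v ++ 0 ∷ p)) w)
  count-noPair-0 v w ¬v = trans (count-++ (noPair? a b) v (0 ∷ w)) (cong₂ _+_
    (countBefore-all (noPair? a b) v (0 ∷ w) λ p₁ p₂ eq →
      ¬v ∘ hasPair-⊆ (subst (p₁ ⊆_) eq (⊆ₚ.++⁺ʳ p₂ ⊆-refl)))
    (cong (_+ count {λ p _ → ¬ HasPair a b (v ++ 0 ∷ p)} (λ p → noPair? a b (v ++ 0 ∷ p)) w)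
      (weight-yes (noPair? a b (v ++ []) (0 ∷ w)) (¬v ∘ subst (HasPair a b) (++-identityʳ v)))))

  count-noPair-0-dead : ∀ v w → ¬ HasPair a b v → (∀ p → HasPair a b (v ++ 0 ∷ p)) →
    count (noPair? a b) (v ++ 0 ∷ w) ≡ suc (length v)
  count-noPair-0-dead v w ¬v dead = trans (count-noPair-0 v w ¬v) (trans
    (cong (λ n → length v + suc n) (count-none _ w (λ p _ ¬p → ¬p (dead p))))
    (+-comm (length v) 1))

  -- The 0 and the next letter `y` form a pair, so the site between them is the last active one.
  count-noPair-0x-dead : ∀ v y w → ¬ HasPair a b v → ¬ HasPair a b (v ++ 0 ∷ []) → Like a b 0 y →
    count (noPair? a b) (v ++ 0 ∷ y ∷ w) ≡ 2 + length v
  count-noPair-0x-dead v y w ¬v ¬v0 0y = trans (count-noPair-0 v (y ∷ w) ¬v) (trans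
    (cong (λ n → length v + suc n) (cong₂ _+_
      (weight-yes (noPair? a b (v ++ 0 ∷ []) (y ∷ w)) ¬v0)
      (count-none _ w (λ p _ ¬p → ¬p (hasPair-++ v p 0y)))))
    (+-comm (length v) 2))

  -- The left part may contain zeros; the hypothesis says that none of them is in the relation with
  -- a positive letter on the right.
  cross-lower⁻ : (∀ {z} → ¬ Like a b 0 (suc z)) → ∀ w q →
    Crosses a b w (map suc q) → Crosses a b (lower w) q
  cross-lower⁻ ¬0z w q (x , z , x∈ , z∈ , xz) with ∈-map⁻ suc z∈
  cross-lower⁻ ¬0z w q (zero  , _ , x∈ , _ , xz) | z , z∈ , refl = contradiction xz ¬0z
  cross-lower⁻ ¬0z w q (suc x , _ , x∈ , _ , xz) | z , z∈ , refl =
    x , z , ∈-lower⁺ w x∈ , z∈ , like-pred a b xz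

  cross-lower⁺ : ∀ w q → Crosses a b (lower w) q → Crosses a b w (map suc q)
  cross-lower⁺ w q (x , z , x∈ , z∈ , xz) =
    suc x , suc z , ∈-lower⁻ w x∈ , ∈-map⁺ suc z∈ , like-suc a b xz

  module _ (¬0z : ∀ {z} → ¬ Like a b 0 (suc z)) where

    countAfter-noCross : ∀ v q →
      countAfter (noCross? a b) (lastZero v []) (map suc q) ≡ countAfter (noCross? a b) (lower v) q
    countAfter-noCross v q = count-map-suc _ _ q λ p r → subst
      (λ w → (¬ Crosses a b (lastZero v [] ++ map suc p) (map suc r)) ⇔ (¬ Crosses a b w r))
      (lower-lastZero-++ p)
      (contraposition⇔ (cross-lower⁻ ¬0z _ r) (cross-lower⁺ _ r))
      where
      lower-lastZero-++ : ∀ p → lower (lastZero v [] ++ map suc p) ≡ lower v ++ p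
      lower-lastZero-++ p = trans (cong lower (++-assoc v (0 ∷ []) (map suc p))) (lower-lastZero v p)

    -- A site between y and the last 0 is inactive, since y and 0 cross it.
    count-noCross-dead : ∀ y v q → Like a b y 0 →
      count (noCross? a b) (lastZero (y ∷ v) q) ≡ suc (countAfter (noCross? a b) (lower (y ∷ v)) q)
    count-noCross-dead y v q y0 = cong₂ _+_
      (weight-yes (noCross? a b [] (lastZero (y ∷ v) q)) λ { (_ , _ , () , _) })
      (begin
        count (noCross? a b ∘ (y ∷_)) (lastZero v q)
          ≡⟨ count-++ (noCross? a b ∘ (y ∷_)) v (0 ∷ map suc q) ⟩
        countBefore (noCross? a b ∘ (y ∷_)) v (0 ∷ map suc q) +
        countAfter (noCross? a b ∘ (y ∷_)) v (0 ∷ map suc q)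
          ≡⟨ cong₂ _+_
            (countBefore-none _ v _ λ p₁ p₂ ¬c → ¬c (y , 0 , here refl , ∈-insert p₂ , y0))
            (cong₂ _+_
              (weight-no (noCross? a b (y ∷ v ++ []) _) λ ¬c → ¬c (y , 0 , here refl , here refl , y0))
              (count-cong {t = λ p r → ¬ Crosses a b (lastZero (y ∷ v) [] ++ p) r} _
                (noCross? a b ∘ (lastZero (y ∷ v) [] ++_)) (map suc q) λ p r →
                subst (λ w → (¬ Crosses a b (y ∷ w) r) ⇔ (¬ Crosses a b (lastZero (y ∷ v) [] ++ p) r))
                  (++-assoc v (0 ∷ []) p) (mk⇔ id id))) ⟩
        countAfter (noCross? a b) (lastZero (y ∷ v) []) (map suc q)
          ≡⟨ countAfter-noCross (y ∷ v) q ⟩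
        countAfter (noCross? a b) (lower (y ∷ v)) q  ∎)
      where open ≡-Reasoning

  count-noPair-map-suc : ∀ u → count (noPair? a b) (map suc u) ≡ count (noPair? a b) u
  count-noPair-map-suc u = count-map-suc _ _ u λ p _ → noPair-map-suc p

  noCross-map-suc : ∀ p q → (¬ Crosses a b (map suc p) (map suc q)) ⇔ (¬ Crosses a b p q)
  noCross-map-suc p q = contraposition⇔ ⇒ ⇐
    where
    ⇒ : Crosses a b (map suc p) (map suc q) → Crosses a b p q
    ⇒ (_ , _ , x∈ , z∈ , xz) with ∈-map⁻ suc x∈ | ∈-map⁻ suc z∈
    ... | x , x∈′ , refl | z , z∈′ , refl = x , z , x∈′ , z∈′ , like-pred a b xz
    ⇐ : Crosses a b p q → Crosses a b (map suc p) (map suc q)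
    ⇐ (x , z , x∈ , z∈ , xz) = suc x , suc z , ∈-map⁺ suc x∈ , ∈-map⁺ suc z∈ , like-suc a b xz

  count-noCross-map-suc : ∀ u → count (noCross? a b) (map suc u) ≡ count (noCross? a b) u
  count-noCross-map-suc u = count-map-suc _ _ u noCross-map-suc

module _ {s : Site} (s? : Decidableˢ s) (s[] : ∀ q → s [] q)
         (s-0∷ : ∀ p q → s (0 ∷ p) q ⇔ s p q) where

  -- A leading 0 is invisible to the condition at later sites, and the site in front of it is always
  -- active.
  count-0s : ∀ n w → count s? (replicate n 0 ++ w) ≡ n + count s? w
  count-0s zero    w = refl
  count-0s (suc n) w = cong₂ _+_ (weight-yes (s? [] _) (s[] _))
    (trans (count-cong (s? ∘ (0 ∷_)) s? (replicate n 0 ++ w) s-0∷) (count-0s n w))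

noPair-> : ∀ p (_ : Word) → (¬ HasPair 1 0 (0 ∷ p)) ⇔ (¬ HasPair 1 0 p)
noPair-> p _ = contraposition⇔ {HasPair 1 0 (0 ∷ p)}
  (λ { (x , y , _ ∷ʳ τ , xy) → x , y , τ , xy ; (_ , _ , refl ∷ _ , ()) })
  (hasPair-⊆ {1} {0} (0 ∷ʳ ⊆-refl))

noCross-> : ∀ p q → (¬ Crosses 1 0 (0 ∷ p) q) ⇔ (¬ Crosses 1 0 p q)
noCross-> p q = contraposition⇔ {Crosses 1 0 (0 ∷ p) q}
  (λ { (x , z , there x∈ , z∈ , xz) → x , z , x∈ , z∈ , xz ; (_ , _ , here refl , _ , ()) })
  (λ { (x , z , x∈ , z∈ , xz) → x , z , there x∈ , z∈ , xz })

-- From sites to growth rules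

weight-× : ∀ {A B C : Set} (C? : Dec C) (A? : Dec A) (B? : Dec B) {m n} →
  (C → A × B) → (A → B → C) → (A → B → m ≡ n) → weight C? m ≡ weight A? (weight B? n)
weight-× C? (no ¬a)  B?      ⇒ ⇐ eq = weight-no C? (¬a ∘ proj₁ ∘ ⇒)
weight-× C? (yes a) (no ¬b)  ⇒ ⇐ eq = weight-no C? (¬b ∘ proj₂ ∘ ⇒)
weight-× C? (yes a) (yes b)  ⇒ ⇐ eq = trans (weight-yes C? (⇐ a b)) (eq a b)

Σsplits-weight : ∀ {A : Set} (A? : Dec A) h u → Σsplits (λ p q → weight A? (h p q)) u ≡ weight A? (Σsplits h u)
Σsplits-weight (yes _) h u = refl
Σsplits-weight (no _)  h u = Σsplits-zero u

first : ℕ → (ℕ → ℕ) → ℕ → ℕ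
first x f zero    = x
first x f (suc i) = f i

-- The left side lists the same summands with the last one moved to the front. It reconciles trees
-- that produce the same child labels at different sites.
Σ<-rotate : ∀ c f → Σ< c (first (f (pred c)) f) ≡ Σ< c f
Σ<-rotate zero    f = refl
Σ<-rotate (suc m) f = Σ<-suc m (first (f m) f)

-- The sites with no pair before them form an initial segment, so the number of active sites before
-- an active one is just the length of the prefix.
Σsplits-noPair : ∀ a b g u → Σsplits (λ p q → weight (noPair? a b p q) (g (length p))) u ≡
                             Σ< (count (noPair? a b) u) g
Σsplits-noPair a b g u = trans
  (Σsplits-cong u λ p q _ → weight-cong (noPair? a b p q) (noPair? a b p q) (mk⇔ id id) λ ¬p →
    cong g (sym (countBefore-all (noPair? a b) p q λ p₁ p₂ eq →
      ¬p ∘ hasPair-⊆ {a} {b} (subst (p₁ ⊆_) eq (⊆ₚ.++⁺ʳ p₂ ⊆-refl)))))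
  (Σsplits-before (noPair? a b) g u)

Σsplits-length : ∀ f u → Σsplits (λ p q → f (length p)) u ≡ Σ< (suc (length u)) f
Σsplits-length f []      = sym (+-identityʳ (f 0))
Σsplits-length f (x ∷ u) = trans (cong (f 0 +_) (Σsplits-length (f ∘ suc) u)) (sym (Σ<-suc (suc (length u)) f))

module _ {a b c d e f : ℕ} {Zero Zero′ : Word → Set}
         (Z : ZeroOccurrences a b c Zero) (Z′ : ZeroOccurrences d e f Zero′) where

  private
    P : List Word
    P = (a ∷ b ∷ c ∷ []) ∷ (d ∷ e ∷ f ∷ []) ∷ []

  vanishes : ∀ {w} (h : Word → ℕ) → Zero w ⊎ Zero′ w → weight (avoidsAll? P w) (h w) ≡ 0
  vanishes {w} h z = weight-no (avoidsAll? P w) λ av → let (_ , ¬z , ¬z′) = avoids-lower⁻ Z Z′ w av in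
    [ ¬z , ¬z′ ]′ z

  -- `before p` is what precedes the last 0. Deleting the zeros gives back `u` for every split, so
  -- avoidance by `u` factors out of the sum and what remains is the condition `s` on the site.
  grow-by-splits : ∀ (score : Word → ℕ) {n u} (before : Word → Word) {s : Site}
    (s? : Decidableˢ s) (H : Word → Word → ℕ) →
    sumOver (λ w → weight (avoidsAll? P w) (score w)) (shuffles (suc n) u) ≡
      Σsplits (λ p q → weight (avoidsAll? P (lastZero (before p) q)) (score (lastZero (before p) q))) u →
    (∀ p → lower (before p) ≡ p) →
    (∀ p q → ¬ Zero (lastZero (before p) q) → ¬ Zero′ (lastZero (before p) q) → s p q) →
    (∀ p q → s p q → ¬ Zero (lastZero (before p) q) × ¬ Zero′ (lastZero (before p) q)) →
    (∀ p q → p ++ q ≡ u → s p q → score (lastZero (before p) q) ≡ H p q) →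
    sumOver (λ w → weight (avoidsAll? P w) (score w)) (shuffles (suc n) u) ≡
      weight (avoidsAll? P u) (Σsplits (λ p q → weight (s? p q) (H p q)) u)
  grow-by-splits score {u = u} before s? H shape lower-before s⁺ s⁻ eq = trans shape (trans
    (Σsplits-cong u λ p q p++q≡u → weight-× (avoidsAll? P (lastZero (before p) q)) (avoidsAll? P u) (s? p q)
      (λ av → let (av′ , ¬z , ¬z′) = avoids-lower⁻ Z Z′ (lastZero (before p) q) av in
         subst (λ w → All (Avoids w) P) (lower≡u p q p++q≡u) av′ , s⁺ p q ¬z ¬z′)
      (λ av spq → let (¬z , ¬z′) = s⁻ p q spq in
         avoids-lower⁺ Z Z′ (lastZero (before p) q)
           (subst (λ w → All (Avoids w) P) (sym (lower≡u p q p++q≡u)) av) ¬z ¬z′)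
      (λ _ → eq p q p++q≡u))
    (Σsplits-weight (avoidsAll? P u) (λ p q → weight (s? p q) (H p q)) u))
    where
    lower≡u : ∀ p q → p ++ q ≡ u → lower (lastZero (before p) q) ≡ u
    lower≡u p q p++q≡u = trans (lower-lastZero (before p) q) (trans (cong (_++ q) (lower-before p)) p++q≡u)

-- Trees for 121 or 211 with 321, 312 or 231

blocked : ℕ → Word → Word
blocked n p = map suc p ++ replicate n 0

fronted : ℕ → Word → Word
fronted n p = replicate n 0 ++ map suc p

replicate-∷ : ∀ n w → 0 ∷ replicate n 0 ++ w ≡ replicate n 0 ++ 0 ∷ w
replicate-∷ zero    w = refl
replicate-∷ (suc n) w = cong (0 ∷_) (replicate-∷ n w)

lastZero-blocked : ∀ n p q → lastZero (blocked n p) q ≡ map suc p ++ 0 ∷ replicate n 0 ++ map suc q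
lastZero-blocked n p q = trans (++-assoc (map suc p) (replicate n 0) _)
  (cong (map suc p ++_) (sym (replicate-∷ n (map suc q))))

lastZero-fronted : ∀ n p q → lastZero (fronted n p) q ≡ replicate n 0 ++ lastZero (map suc p) q
lastZero-fronted n p q = ++-assoc (replicate n 0) (map suc p) _

-- Like 1 0, Like 0 1 and Like 0 0 are the relations _>_, _<_ and _≡_.
label₃₂₁ label₃₁₂ label₂₃₁ label₂₂₁ label₂₁₂ : Word → ℕ
label₃₂₁ = count (noPair? 1 0)
label₃₁₂ = count (noCross? 1 0)
label₂₃₁ = count (noPair? 0 1)
label₂₂₁ = count (noPair? 0 0)
label₂₁₂ = count (noCross? 0 0)

label₃₂₁-0s : ∀ n w → label₃₂₁ (replicate n 0 ++ w) ≡ n + label₃₂₁ w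
label₃₂₁-0s = count-0s (noPair? 1 0) (λ { _ (_ , _ , () , _) }) noPair->

label₃₁₂-0s : ∀ n w → label₃₁₂ (replicate n 0 ++ w) ≡ n + label₃₁₂ w
label₃₁₂-0s = count-0s (noCross? 1 0) (λ { _ (_ , _ , () , _) }) noCross->

label₃₂₁-lastZero : ∀ n u → label₃₂₁ (lastZero (replicate n 0) u) ≡ label₃₂₁ u + suc n
label₃₂₁-lastZero n u = begin
  label₃₂₁ (replicate n 0 ++ 0 ∷ map suc u)   ≡⟨ label₃₂₁-0s n _ ⟩
  n + label₃₂₁ (0 ∷ map suc u)                ≡⟨ cong (n +_) (label₃₂₁-0s 1 (map suc u)) ⟩
  n + suc (label₃₂₁ (map suc u))              ≡⟨ cong (λ c → n + suc c) (count-noPair-map-suc {1} {0} u) ⟩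
  n + suc (label₃₂₁ u)                        ≡⟨ +-comm n _ ⟩
  suc (label₃₂₁ u) + n                        ≡⟨ +-suc (label₃₂₁ u) n ⟨
  label₃₂₁ u + suc n                          ∎
  where open ≡-Reasoning

label₃₁₂-lastZero : ∀ n u → label₃₁₂ (lastZero (replicate n 0) u) ≡ label₃₁₂ u + suc n
label₃₁₂-lastZero n u = begin
  label₃₁₂ (replicate n 0 ++ 0 ∷ map suc u)   ≡⟨ label₃₁₂-0s n _ ⟩
  n + label₃₁₂ (0 ∷ map suc u)                ≡⟨ cong (n +_) (label₃₁₂-0s 1 (map suc u)) ⟩
  n + suc (label₃₁₂ (map suc u))              ≡⟨ cong (λ c → n + suc c) (count-noCross-map-suc {1} {0} u) ⟩
  n + suc (label₃₁₂ u)                        ≡⟨ +-comm n _ ⟩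
  suc (label₃₁₂ u) + n                        ≡⟨ +-suc (label₃₁₂ u) n ⟨
  label₃₁₂ u + suc n                          ∎
  where open ≡-Reasoning

-- The letter `suc x` and the 0 form a descent, so nothing after the 0 is active, while all
-- `2 + length p` sites before it are.
label₃₂₁-after-0 : ∀ x p w → ¬ HasPair 1 0 (x ∷ p) → label₃₂₁ (map suc (x ∷ p) ++ 0 ∷ w) ≡ 2 + length p
label₃₂₁-after-0 x p w ¬p = trans
  (count-noPair-0-dead {1} {0} (map suc (x ∷ p)) w (from (noPair-map-suc {1} {0} (x ∷ p)) ¬p)
    (λ r → suc x , 0 , refl ∷ from∈ (∈-insert (map suc p)) , z<s))
  (cong (2 +_) (length-map suc p))

-- The sites between `suc x` and the last 0 become inactive. The initial site survives, and those
-- after the last 0 correspond to the sites of the old word from the insertion point on.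
label₃₁₂-last-0 : ∀ n x p q →
  label₃₁₂ (lastZero (blocked n (x ∷ p)) q) ≡ suc (countAfter (noCross? 1 0) (x ∷ p) q)
label₃₁₂-last-0 n x p q = trans
  (count-noCross-dead {1} {0} (λ ()) (suc x) (map suc p ++ replicate n 0) q z<s)
  (cong (λ r → suc (countAfter (noCross? 1 0) r q)) (lower-block n (x ∷ p)))

-- The summand at 0 comes from inserting all copies at the front of the word.
firstRule : (ℕ → ℕ) → GrowthRule
firstRule offset a g c = Σ< c (first (g (c + suc a)) (λ i → g (offset a + (2 + i))))

module _ {d e f : ℕ} {Zero : Word → Set} (Z : ZeroOccurrences d e f Zero)
         (score : Word → ℕ) {s : Site} (s? : Decidableˢ s) (n : ℕ) (u : Word)
         (H : Word → Word → ℕ) where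

  private
    ρ : Word
    ρ = d ∷ e ∷ f ∷ []

  grow-blocked :
    (∀ p q → s p q ⇔ (¬ Zero (lastZero (blocked n p) q))) →
    (∀ p q → p ++ q ≡ u → s p q → score (lastZero (blocked n p) q) ≡ H p q) →
    sumOver (λ w → weight (avoidsAll? (w121 ∷ ρ ∷ []) w) (score w)) (shuffles (suc n) u) ≡
    weight (avoidsAll? (w121 ∷ ρ ∷ []) u) (Σsplits (λ p q → weight (s? p q) (H p q)) u)
  grow-blocked s⇔ eq = grow-by-splits zero₁₂₁ Z score {n} {u} (blocked n) s? H
    (sum-shuffles-block (λ w → weight (avoidsAll? (w121 ∷ ρ ∷ []) w) (score w))
      (λ {y} {w} τ → vanishes zero₁₂₁ Z {w} score (inj₁ (y , τ))) n u)
    (lower-block n)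
    (λ p q _ → from (s⇔ p q))
    (λ p q spq → ¬zero₁₂₁-block n p q , to (s⇔ p q) spq)
    eq

  grow-fronted :
    (∀ p q → s p q ⇔ (¬ Zero (lastZero (fronted n p) q))) →
    (∀ p q → p ++ q ≡ u → s p q → score (lastZero (fronted n p) q) ≡ H p q) →
    sumOver (λ w → weight (avoidsAll? (w211 ∷ ρ ∷ []) w) (score w)) (shuffles (suc n) u) ≡
    weight (avoidsAll? (w211 ∷ ρ ∷ []) u) (Σsplits (λ p q → weight (s? p q) (H p q)) u)
  grow-fronted s⇔ eq = grow-by-splits zero₂₁₁ Z score {n} {u} (fronted n) s? H
    (sum-shuffles-front (λ w → weight (avoidsAll? (w211 ∷ ρ ∷ []) w) (score w))
      (λ {x} {w} τ → vanishes zero₂₁₁ Z {w} score (inj₁ (x , τ))) n u)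
    (lower-front n)
    (λ p q _ → from (s⇔ p q))
    (λ p q spq → ¬zero₂₁₁-front n p q , to (s⇔ p q) spq)
    eq

noPair-blocked : ∀ a b n p q → (¬ HasPair a b p) ⇔ (¬ ZeroLast a b (lastZero (blocked n p) q))
noPair-blocked a b n p q = contraposition⇔
  (zeroLast⁺ a b (blocked n p) q ∘ subst (HasPair a b) (sym (lower-block n p)))
  (subst (HasPair a b) (lower-block n p) ∘ zeroLast⁻ a b (blocked n p) q)

noPair-fronted : ∀ a b n p q → (¬ HasPair a b p) ⇔ (¬ ZeroLast a b (lastZero (fronted n p) q))
noPair-fronted a b n p q = contraposition⇔
  (zeroLast⁺ a b (fronted n p) q ∘ subst (HasPair a b) (sym (lower-front n p)))
  (subst (HasPair a b) (lower-front n p) ∘ zeroLast⁻ a b (fronted n p) q)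

noCross-blocked : ∀ a b n p q → (¬ Crosses a b p q) ⇔ (¬ ZeroMiddle a b (lastZero (blocked n p) q))
noCross-blocked a b n p q = contraposition⇔
  (zeroMiddle⁺ a b (blocked n p) q ∘ subst (λ r → Crosses a b r q) (sym (lower-block n p)))
  (zeroMiddle-block⁻ n a b p q)

noCross-fronted : ∀ a b n p q → (¬ Crosses a b p q) ⇔ (¬ ZeroMiddle a b (lastZero (fronted n p) q))
noCross-fronted a b n p q = contraposition⇔
  (zeroMiddle⁺ a b (fronted n p) q ∘ subst (λ r → Crosses a b r q) (sym (lower-front n p)))
  (zeroMiddle-front⁻ n a b p q)

threes : ∀ {a b c d e f} → All LengthThree ((a ∷ b ∷ c ∷ []) ∷ (d ∷ e ∷ f ∷ []) ∷ [])
threes = (_ , _ , _ , refl) ∷ (_ , _ , _ , refl) ∷ []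

generatedBy-121-321 : GeneratedBy (firstRule (const 0)) (w121 ∷ w321 ∷ [])
generatedBy-121-321 = record
  { three    = threes
  ; label    = label₃₂₁
  ; label-[] = refl
  ; grow     = λ n g u → let h = first (g (label₃₂₁ u + suc n)) (λ i → g (2 + i)) in trans
      (grow-blocked (zeroLast 1 0) (g ∘ label₃₂₁) (noPair? 1 0) n u (λ p _ → h (length p))
        (noPair-blocked 1 0 n)
        (λ { []      q refl _ → cong g (label₃₂₁-lastZero n u)
           ; (x ∷ p) q _ ¬p → cong g (trans (cong label₃₂₁ (lastZero-blocked n (x ∷ p) q))
               (label₃₂₁-after-0 x p (replicate n 0 ++ map suc q) ¬p)) }))
      (cong (weight (avoidsAll? (w121 ∷ w321 ∷ []) u)) (Σsplits-noPair 1 0 h u))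
  }

generatedBy-211-321 : GeneratedBy (firstRule id) (w211 ∷ w321 ∷ [])
generatedBy-211-321 = record
  { three    = threes
  ; label    = label₃₂₁
  ; label-[] = refl
  ; grow     = λ n g u → let h = first (g (label₃₂₁ u + suc n)) (λ i → g (n + (2 + i))) in trans
      (grow-fronted (zeroLast 1 0) (g ∘ label₃₂₁) (noPair? 1 0) n u (λ p _ → h (length p))
        (noPair-fronted 1 0 n)
        (λ { []      q refl _ → cong g (trans
               (cong (λ v → label₃₂₁ (lastZero v u)) (++-identityʳ (replicate n 0)))
               (label₃₂₁-lastZero n u))
           ; (x ∷ p) q _ ¬p → cong g (trans (cong label₃₂₁ (lastZero-fronted n (x ∷ p) q))
               (trans (label₃₂₁-0s n _) (cong (n +_) (label₃₂₁-after-0 x p (map suc q) ¬p)))) }))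
      (cong (weight (avoidsAll? (w211 ∷ w321 ∷ []) u)) (Σsplits-noPair 1 0 h u))
  }

-- The empty prefix is separate because zeros inserted at the front deactivate no site; `c` is the
-- value there.
sites₃₁₂ : (c : ℕ) (f : ℕ → ℕ) → Word → Word → ℕ
sites₃₁₂ c f []      q = c
sites₃₁₂ c f (x ∷ p) q = f (countAfter (noCross? 1 0) (x ∷ p) q)

Σsplits-sites₃₁₂ : ∀ c f u → Σsplits (λ p q → weight (noCross? 1 0 p q) (sites₃₁₂ c f p q)) u ≡
                   Σ< (label₃₁₂ u) (first c (f ∘ suc))
Σsplits-sites₃₁₂ c f []      = sym (+-identityʳ c)
Σsplits-sites₃₁₂ c f (x ∷ u) = trans
  (cong (c +_) (Σsplits-after (noCross? 1 0 ∘ (x ∷_)) f u))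
  (sym (Σ<-suc (count (noCross? 1 0 ∘ (x ∷_)) u) (first c (f ∘ suc))))

generatedBy-121-312 : GeneratedBy (firstRule (const 0)) (w121 ∷ w312 ∷ [])
generatedBy-121-312 = record
  { three    = threes
  ; label    = label₃₁₂
  ; label-[] = refl
  ; grow     = λ n g u → let c = g (label₃₁₂ u + suc n) in trans
      (grow-blocked (zeroMiddle 1 0) (g ∘ label₃₁₂) (noCross? 1 0) n u (sites₃₁₂ c (g ∘ suc))
        (noCross-blocked 1 0 n)
        (λ { []      q refl _ → cong g (label₃₁₂-lastZero n u)
           ; (x ∷ p) q _ _    → cong g (label₃₁₂-last-0 n x p q) }))
      (cong (weight (avoidsAll? (w121 ∷ w312 ∷ []) u)) (Σsplits-sites₃₁₂ c (g ∘ suc) u))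
  }

generatedBy-211-312 : GeneratedBy (firstRule id) (w211 ∷ w312 ∷ [])
generatedBy-211-312 = record
  { three    = threes
  ; label    = label₃₁₂
  ; label-[] = refl
  ; grow     = λ n g u → let c = g (label₃₁₂ u + suc n) in trans
      (grow-fronted (zeroMiddle 1 0) (g ∘ label₃₁₂) (noCross? 1 0) n u (sites₃₁₂ c (λ i → g (n + suc i)))
        (noCross-fronted 1 0 n)
        (λ { []      q refl _ → cong g (trans
               (cong (λ v → label₃₁₂ (lastZero v u)) (++-identityʳ (replicate n 0)))
               (label₃₁₂-lastZero n u))
           ; (x ∷ p) q _ _    → cong g (trans (cong label₃₁₂ (lastZero-fronted n (x ∷ p) q))
               (trans (label₃₁₂-0s n _) (cong (n +_)
                 (trans (cong (λ v → label₃₁₂ (lastZero v q)) (sym (++-identityʳ (map suc (x ∷ p)))))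
                        (label₃₁₂-last-0 0 x p q))))) }))
      (cong (weight (avoidsAll? (w211 ∷ w312 ∷ []) u)) (Σsplits-sites₃₁₂ c (λ i → g (n + suc i)) u))
  }

weight-0 : ∀ {A : Set} (A? : Dec A) → weight A? 0 ≡ 0
weight-0 (yes _) = refl
weight-0 (no _)  = refl

length-blocked : ∀ n p → length (blocked n p) ≡ length p + n
length-blocked n p = trans (length-++ (map suc p)) (cong₂ _+_ (length-map suc p) (length-replicate n))

length-fronted : ∀ n p → length (fronted n p) ≡ length p + n
length-fronted n p = trans (length-++ (replicate n 0))
  (trans (cong₂ _+_ (length-replicate n) (length-map suc p)) (+-comm n (length p)))

noAscent-blocked : ∀ n p → ¬ HasPair 0 1 p → ¬ HasPair 0 1 (blocked n p)
noAscent-blocked n p ¬p (zero , suc y , τ , _)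
  with subst (_ ⊆_) (lower-block n []) (lower-⊆ (drop-positives p τ))
... | ()
noAscent-blocked n p ¬p (suc x , suc y , τ , x<y) =
  ¬p (x , y , subst (_ ⊆_) (lower-block n p) (lower-⊆ τ) , s<s⁻¹ x<y)

-- Without ascents `p` is weakly decreasing, and so is `p` followed by the zeros; any letter of `q`
-- then makes an ascent with a 0. The active sites are exactly those up to the end of the block.
label₂₃₁-lastZero : ∀ n p q → ¬ HasPair 0 1 p →
                    label₂₃₁ (lastZero (blocked n p) q) ≡ n + (2 + length p)
label₂₃₁-lastZero n p q ¬p = trans (go q) (trans (cong (2 +_) (length-blocked n p)) (arith (length p) n))
  where
  ¬v : ¬ HasPair 0 1 (blocked n p)
  ¬v = noAscent-blocked n p ¬p
  ¬v0 : ¬ HasPair 0 1 (lastZero (blocked n p) [])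
  ¬v0 = subst (λ w → ¬ HasPair 0 1 w)
    (sym (trans (lastZero-blocked n p []) (cong (λ w → map suc p ++ 0 ∷ w) (++-identityʳ (replicate n 0)))))
    (noAscent-blocked (suc n) p ¬p)
  go : ∀ q → label₂₃₁ (lastZero (blocked n p) q) ≡ 2 + length (blocked n p)
  go []      = trans (count-noPair-0 {0} {1} (blocked n p) [] ¬v) (trans
    (cong (λ k → length (blocked n p) + suc k) (weight-yes (noPair? 0 1 (lastZero (blocked n p) []) []) ¬v0))
    (+-comm (length (blocked n p)) 2))
  go (y ∷ q) = count-noPair-0x-dead {0} {1} (blocked n p) (suc y) (map suc q) ¬v ¬v0 z<s
  arith : ∀ m n → 2 + (m + n) ≡ n + (2 + m)
  arith = solve-∀

generatedBy-121-231 : GeneratedBy (firstRule id) (w121 ∷ w231 ∷ [])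
generatedBy-121-231 = record
  { three    = threes
  ; label    = label₂₃₁
  ; label-[] = refl
  ; grow     = λ n g u → let h = λ i → g (n + (2 + i)) in trans
      (grow-blocked (zeroLast 0 1) (g ∘ label₂₃₁) (noPair? 0 1) n u (λ p _ → h (length p))
        (noPair-blocked 0 1 n)
        (λ p q _ ¬p → cong g (label₂₃₁-lastZero n p q ¬p)))
      (cong (weight (avoidsAll? (w121 ∷ w231 ∷ []) u))
        (trans (Σsplits-noPair 0 1 h u) (rotate n g (label₂₃₁ u))))
  }
  where
  -- At the last active site `i = c - 1` the label `n + (2 + i)` equals `c + suc n`, which
  -- `firstRule` lists first.
  rotate : ∀ n g c → Σ< c (λ i → g (n + (2 + i))) ≡ firstRule id n g c
  rotate n g zero    = refl
  rotate n g (suc m) = trans (sym (Σ<-rotate (suc m) (λ i → g (n + (2 + i)))))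
    (cong (λ k → Σ< (suc m) (first (g k) (λ i → g (n + (2 + i))))) (arith n m))
    where
    arith : ∀ n m → n + (2 + m) ≡ suc m + suc n
    arith = solve-∀

-- Trees for 121 with 221 and for 211 with 212

-- A single copy of a new letter repeats nothing: all sites survive, and the one used becomes two.
-- From two copies on, the repeated 0 cuts off every site on one side, however many copies there
-- are.
repeatRule : GrowthRule
repeatRule zero    g c = Σ< c (const (g (suc c)))
repeatRule (suc n) g c = Σ< c (λ i → g (2 + i))

noRepeat-lastZero : ∀ p r → (¬ HasPair 0 0 (lastZero (map suc p) r)) ⇔ (¬ HasPair 0 0 (p ++ r))
noRepeat-lastZero p r = contraposition⇔ ⇒ ⇐
  where
  lower≡ : lower (lastZero (map suc p) r) ≡ p ++ r
  lower≡ = trans (lower-lastZero (map suc p) r) (cong (_++ r) (lower-map-suc p))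
  ⇒ : HasPair 0 0 (lastZero (map suc p) r) → HasPair 0 0 (p ++ r)
  ⇒ (zero  , _ , τ , refl) = contradiction τ (00⊈lastZero p r)
  ⇒ (suc x , _ , τ , refl) = x , x , subst (_ ⊆_) lower≡ (lower-⊆ τ) , refl
  ⇐ : HasPair 0 0 (p ++ r) → HasPair 0 0 (lastZero (map suc p) r)
  ⇐ = hasPair-lower⁺ {0} {0} _ ∘ subst (HasPair 0 0) (sym lower≡)

noPair-prefix : ∀ {a b} p₁ p₂ {p} → p₁ ++ p₂ ≡ p → ¬ HasPair a b p → ¬ HasPair a b p₁
noPair-prefix {a} {b} p₁ p₂ eq ¬p = ¬p ∘ hasPair-⊆ {a} {b} (subst (p₁ ⊆_) eq (⊆ₚ.++⁺ʳ p₂ ⊆-refl))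

label₂₂₁-one : ∀ p q → ¬ HasPair 0 0 p → label₂₂₁ (lastZero (map suc p) q) ≡ suc (label₂₂₁ (p ++ q))
label₂₂₁-one p q ¬p = begin
  label₂₂₁ (lastZero (map suc p) q)
    ≡⟨ count-noPair-0 {0} {0} (map suc p) (map suc q) (from (noPair-map-suc {0} {0} p) ¬p) ⟩
  length (map suc p) + suc (count (λ r → noPair? 0 0 (map suc p ++ 0 ∷ r)) (map suc q))
    ≡⟨ cong₂ (λ m c → m + suc c) (length-map suc p)
         (count-map-suc (λ r → noPair? 0 0 (map suc p ++ 0 ∷ r)) (λ r → noPair? 0 0 (p ++ r)) q
           (λ r _ → noRepeat-lastZero p r)) ⟩
  length p + suc (countAfter (noPair? 0 0) p q)
    ≡⟨ +-suc (length p) _ ⟩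
  suc (length p + countAfter (noPair? 0 0) p q)
    ≡⟨ cong (λ m → suc (m + countAfter (noPair? 0 0) p q))
         (countBefore-all (noPair? 0 0) p q (λ p₁ p₂ eq → noPair-prefix {0} {0} p₁ p₂ eq ¬p)) ⟨
  suc (countBefore (noPair? 0 0) p q + countAfter (noPair? 0 0) p q)
    ≡⟨ cong suc (count-++ (noPair? 0 0) p q) ⟨
  suc (label₂₂₁ (p ++ q)) ∎
  where open ≡-Reasoning

label₂₂₁-many : ∀ n p q → ¬ HasPair 0 0 p → label₂₂₁ (lastZero (blocked (suc n) p) q) ≡ 2 + length p
label₂₂₁-many n p q ¬p = trans (cong label₂₂₁ (lastZero-blocked (suc n) p q)) (trans
  (count-noPair-0x-dead {0} {0} (map suc p) 0 (replicate n 0 ++ map suc q)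
    (from (noPair-map-suc {0} {0} p) ¬p)
    (from (noRepeat-lastZero p []) (subst (λ r → ¬ HasPair 0 0 r) (sym (++-identityʳ p)) ¬p))
    refl)
  (cong (2 +_) (length-map suc p)))

generatedBy-121-221 : GeneratedBy repeatRule (w121 ∷ w221 ∷ [])
generatedBy-121-221 = record
  { three    = threes
  ; label    = label₂₂₁
  ; label-[] = refl
  ; grow     = grow
  }
  where
  grow : ∀ n g u →
    sumOver (λ w → weight (avoidsAll? (w121 ∷ w221 ∷ []) w) (g (label₂₂₁ w))) (shuffles (suc n) u) ≡
    weight (avoidsAll? (w121 ∷ w221 ∷ []) u) (repeatRule n g (label₂₂₁ u))
  grow zero g u = trans
    (grow-blocked (zeroLast 0 0) (g ∘ label₂₂₁) (noPair? 0 0) 0 u (λ _ _ → g (suc (label₂₂₁ u)))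
      (noPair-blocked 0 0 0)
      (λ { p q refl ¬p → cong g (trans (cong (λ v → label₂₂₁ (lastZero v q)) (++-identityʳ (map suc p)))
                                       (label₂₂₁-one p q ¬p)) }))
    (cong (weight (avoidsAll? (w121 ∷ w221 ∷ []) u))
      (Σsplits-noPair 0 0 (const (g (suc (label₂₂₁ u)))) u))
  grow (suc n) g u = trans
    (grow-blocked (zeroLast 0 0) (g ∘ label₂₂₁) (noPair? 0 0) (suc n) u (λ p _ → g (2 + length p))
      (noPair-blocked 0 0 (suc n))
      (λ p q _ ¬p → cong g (label₂₂₁-many n p q ¬p)))
    (cong (weight (avoidsAll? (w121 ∷ w221 ∷ []) u)) (Σsplits-noPair 0 0 (λ i → g (2 + i)) u))

noRepeat-cross : ∀ p r q → (¬ Crosses 0 0 (map suc p) (lastZero (map suc r) q)) ⇔ (¬ Crosses 0 0 p (r ++ q))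
noRepeat-cross p r q = contraposition⇔ ⇒ ⇐
  where
  lower≡ : lower (lastZero (map suc r) q) ≡ r ++ q
  lower≡ = trans (lower-lastZero (map suc r) q) (cong (_++ q) (lower-map-suc r))
  ⇒ : Crosses 0 0 (map suc p) (lastZero (map suc r) q) → Crosses 0 0 p (r ++ q)
  ⇒ (_ , _ , x∈ , z∈ , refl) with ∈-map⁻ suc x∈
  ... | x , x∈′ , refl = x , x , x∈′ , subst (x ∈_) lower≡ (∈-lower⁺ _ z∈) , refl
  ⇐ : Crosses 0 0 p (r ++ q) → Crosses 0 0 (map suc p) (lastZero (map suc r) q)
  ⇐ (x , _ , x∈ , z∈ , refl) =
    suc x , suc x , ∈-map⁺ suc x∈ , ∈-lower⁻ _ (subst (x ∈_) (sym lower≡) z∈) , refl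

label₂₁₂-one : ∀ p q → ¬ Crosses 0 0 p q → label₂₁₂ (lastZero (map suc p) q) ≡ suc (label₂₁₂ (p ++ q))
label₂₁₂-one p q ¬c = begin
  label₂₁₂ (lastZero (map suc p) q)
    ≡⟨ count-++ (noCross? 0 0) (map suc p) (0 ∷ map suc q) ⟩
  countBefore (noCross? 0 0) (map suc p) (0 ∷ map suc q) +
    (weight (noCross? 0 0 (map suc p ++ []) (0 ∷ map suc q)) 1 +
     count (λ r → noCross? 0 0 (map suc p ++ 0 ∷ r)) (map suc q))
    ≡⟨ cong₂ _+_
         (countBefore-map-suc (noCross? 0 0) (noCross? 0 0) p (0 ∷ map suc q) q
           (λ p₁ p₂ → noRepeat-cross p₁ p₂ q))
         (cong₂ _+_
           (weight-yes (noCross? 0 0 (map suc p ++ []) (0 ∷ map suc q))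
             (subst (λ v → ¬ Crosses 0 0 v (0 ∷ map suc q)) (sym (++-identityʳ (map suc p)))
               (from (noRepeat-cross p [] q) ¬c)))
           (count-map-suc (λ r → noCross? 0 0 (map suc p ++ 0 ∷ r)) (λ r → noCross? 0 0 (p ++ r)) q
             (λ r s → subst (λ v → (¬ Crosses 0 0 (lastZero (map suc p) r) (map suc s)) ⇔ (¬ Crosses 0 0 v s))
               (trans (lower-lastZero (map suc p) r) (cong (_++ r) (lower-map-suc p)))
               (contraposition⇔ (cross-lower⁻ {0} {0} (λ ()) (lastZero (map suc p) r) s)
                                (cross-lower⁺ {0} {0} (lastZero (map suc p) r) s))))) ⟩
  countBefore (noCross? 0 0) p q + suc (countAfter (noCross? 0 0) p q)
    ≡⟨ +-suc (countBefore (noCross? 0 0) p q) _ ⟩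
  suc (countBefore (noCross? 0 0) p q + countAfter (noCross? 0 0) p q)
    ≡⟨ cong suc (count-++ (noCross? 0 0) p q) ⟨
  suc (label₂₁₂ (p ++ q)) ∎
  where open ≡-Reasoning

-- The 0 at the front and the last 0 deactivate all sites between them. What remains is the initial
-- site and the surviving sites after the last 0.
label₂₁₂-many : ∀ n p q → label₂₁₂ (lastZero (fronted (suc n) p) q) ≡ suc (countAfter (noCross? 0 0) p q)
label₂₁₂-many n p q = trans (count-noCross-dead {0} {0} (λ ()) 0 (fronted n p) q refl)
  (cong (λ r → suc (countAfter (noCross? 0 0) r q)) (lower-front n p))

generatedBy-211-212 : GeneratedBy repeatRule (w211 ∷ w212 ∷ [])
generatedBy-211-212 = record
  { three    = threes
  ; label    = label₂₁₂
  ; label-[] = refl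
  ; grow     = grow
  }
  where
  grow : ∀ n g u →
    sumOver (λ w → weight (avoidsAll? (w211 ∷ w212 ∷ []) w) (g (label₂₁₂ w))) (shuffles (suc n) u) ≡
    weight (avoidsAll? (w211 ∷ w212 ∷ []) u) (repeatRule n g (label₂₁₂ u))
  grow zero g u = trans
    (grow-fronted (zeroMiddle 0 0) (g ∘ label₂₁₂) (noCross? 0 0) 0 u (λ _ _ → g (suc (label₂₁₂ u)))
      (noCross-fronted 0 0 0)
      (λ { p q refl ¬c → cong g (label₂₁₂-one p q ¬c) }))
    (cong (weight (avoidsAll? (w211 ∷ w212 ∷ []) u))
      (Σsplits-after (noCross? 0 0) (const (g (suc (label₂₁₂ u)))) u))
  grow (suc n) g u = trans
    (grow-fronted (zeroMiddle 0 0) (g ∘ label₂₁₂) (noCross? 0 0) (suc n) u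
      (λ p q → g (suc (countAfter (noCross? 0 0) p q)))
      (noCross-fronted 0 0 (suc n))
      (λ p q _ _ → cong g (label₂₁₂-many n p q)))
    (cong (weight (avoidsAll? (w211 ∷ w212 ∷ []) u)) (Σsplits-after (noCross? 0 0) (g ∘ suc) u))

-- Trees for pairs containing 111

sum-shuffles-111 : ∀ {d e f Zero} (Z : ZeroOccurrences d e f Zero) score n u →
  sumOver (λ w → weight (avoidsAll? ((d ∷ e ∷ f ∷ []) ∷ w111 ∷ []) w) (score w)) (shuffles (3 + n) u) ≡ 0
sum-shuffles-111 Z score n u = sumOver-zero (shuffles (3 + n) u) λ {w} w∈ → vanishes Z zero₁₁₁ {w} score
  (inj₂ (⊆-trans (refl ∷ refl ∷ refl ∷ minimum _) (zeros⊆shuffle (3 + n) u w∈)))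

-- The clauses stand for one, two and at least three copies. With 121 or 211 as the other pattern
-- every site is active, so the label is one more than the length.
shortRule : GrowthRule
shortRule 0             g c = Σ< c (const (g (c + 1)))
shortRule 1             g c = Σ< c (const (g (c + 2)))
shortRule (suc (suc n)) g c = 0

anySite? : Decidableˢ (λ _ _ → ⊤)
anySite? _ _ = yes tt

length-lastZero : ∀ {n v} p q → length v ≡ length p + n →
  suc (length (lastZero v q)) ≡ suc (length (p ++ q)) + suc n
length-lastZero {n} {v} p q eq = begin
  suc (length (lastZero v q))                  ≡⟨ cong suc (length-++ v) ⟩
  suc (length v + suc (length (map suc q)))    ≡⟨ cong₂ (λ m k → suc (m + suc k)) eq (length-map suc q) ⟩
  suc (length p + n + suc (length q))          ≡⟨ arith (length p) n (length q) ⟩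
  suc (length p + length q) + suc n            ≡⟨ cong (λ m → suc m + suc n) (length-++ p) ⟨
  suc (length (p ++ q)) + suc n                ∎
  where
  open ≡-Reasoning
  arith : ∀ m n k → suc (m + n + suc k) ≡ suc (m + k) + suc n
  arith = solve-∀

generatedBy-121-111 : GeneratedBy shortRule (w121 ∷ w111 ∷ [])
generatedBy-121-111 = record
  { three    = threes
  ; label    = suc ∘ length
  ; label-[] = refl
  ; grow     = grow
  }
  where
  short : ∀ n g u → (∀ p q → ¬ Zero₁₁₁ (lastZero (blocked n p) q)) →
    sumOver (λ w → weight (avoidsAll? (w121 ∷ w111 ∷ []) w) (g (suc (length w)))) (shuffles (suc n) u) ≡
    weight (avoidsAll? (w121 ∷ w111 ∷ []) u) (Σ< (suc (length u)) (const (g (suc (length u) + suc n))))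
  short n g u ¬zero = trans
    (grow-blocked zero₁₁₁ (g ∘ suc ∘ length) anySite? n u (λ _ _ → g (suc (length u) + suc n))
      (λ p q → mk⇔ (const (¬zero p q)) (const tt))
      (λ { p q refl _ → cong g (length-lastZero {n} {blocked n p} p q (length-blocked n p)) }))
    (cong (weight (avoidsAll? (w121 ∷ w111 ∷ []) u)) (Σsplits-length (const (g (suc (length u) + suc n))) u))
  grow : ∀ n g u →
    sumOver (λ w → weight (avoidsAll? (w121 ∷ w111 ∷ []) w) (g (suc (length w)))) (shuffles (suc n) u) ≡
    weight (avoidsAll? (w121 ∷ w111 ∷ []) u) (shortRule n g (suc (length u)))
  grow 0 g u = short 0 g u λ p q → ¬zero₁₁₁-1 p q ∘
    subst (λ v → Zero₁₁₁ (lastZero v q)) (++-identityʳ (map suc p))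
  grow 1 g u = short 1 g u λ p q → ¬zero₁₁₁-2 p [] q
  grow (suc (suc n)) g u = trans (sum-shuffles-111 zero₁₂₁ (g ∘ suc ∘ length) n u)
    (sym (weight-0 (avoidsAll? (w121 ∷ w111 ∷ []) u)))

generatedBy-211-111 : GeneratedBy shortRule (w211 ∷ w111 ∷ [])
generatedBy-211-111 = record
  { three    = threes
  ; label    = suc ∘ length
  ; label-[] = refl
  ; grow     = grow
  }
  where
  short : ∀ n g u → (∀ p q → ¬ Zero₁₁₁ (lastZero (fronted n p) q)) →
    sumOver (λ w → weight (avoidsAll? (w211 ∷ w111 ∷ []) w) (g (suc (length w)))) (shuffles (suc n) u) ≡
    weight (avoidsAll? (w211 ∷ w111 ∷ []) u) (Σ< (suc (length u)) (const (g (suc (length u) + suc n))))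
  short n g u ¬zero = trans
    (grow-fronted zero₁₁₁ (g ∘ suc ∘ length) anySite? n u (λ _ _ → g (suc (length u) + suc n))
      (λ p q → mk⇔ (const (¬zero p q)) (const tt))
      (λ { p q refl _ → cong g (length-lastZero {n} {fronted n p} p q (length-fronted n p)) }))
    (cong (weight (avoidsAll? (w211 ∷ w111 ∷ []) u)) (Σsplits-length (const (g (suc (length u) + suc n))) u))
  grow : ∀ n g u →
    sumOver (λ w → weight (avoidsAll? (w211 ∷ w111 ∷ []) w) (g (suc (length w)))) (shuffles (suc n) u) ≡
    weight (avoidsAll? (w211 ∷ w111 ∷ []) u) (shortRule n g (suc (length u)))
  grow 0 g u = short 0 g u ¬zero₁₁₁-1
  grow 1 g u = short 1 g u (¬zero₁₁₁-2 [])
  grow (suc (suc n)) g u = trans (sum-shuffles-111 zero₂₁₁ (g ∘ suc ∘ length) n u)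
    (sym (weight-0 (avoidsAll? (w211 ∷ w111 ∷ []) u)))

module _ (a b : ℕ) (score : Word → ℕ) (u : Word) where

  private
    P : List Word
    P = (2 + a ∷ 2 + b ∷ 1 ∷ []) ∷ w111 ∷ []

  grow-once : ∀ H →
    (∀ p q → p ++ q ≡ u → ¬ HasPair a b p → score (lastZero (map suc p) q) ≡ H p q) →
    sumOver (λ w → weight (avoidsAll? P w) (score w)) (shuffles 1 u) ≡
    weight (avoidsAll? P u) (Σsplits (λ p q → weight (noPair? a b p q) (H p q)) u)
  grow-once H eq = grow-by-splits (zeroLast a b) zero₁₁₁ score {0} {u} (map suc) (noPair? a b) H
    (sum-shuffles-1 (λ w → weight (avoidsAll? P w) (score w)) u)
    lower-map-suc
    (λ p q ¬z _ → from (noPair-fronted a b 0 p q) ¬z)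
    (λ p q ¬p → to (noPair-fronted a b 0 p q) ¬p , ¬zero₁₁₁-1 p q)
    eq

  -- A pair before the first 0 also precedes the second, so only the site of the second 0 is
  -- constrained and the first may go anywhere to its left.
  grow-twice :
    sumOver (λ w → weight (avoidsAll? P w) (score w)) (shuffles 2 u) ≡
    weight (avoidsAll? P u) (Σsplits (λ v r → weight (noPair? a b v r)
      (Σsplits (λ p q → score (lastZero (lastZero (map suc p) q) r)) v)) u)
  grow-twice = trans (sum-shuffles-2 (λ w → weight (avoidsAll? P w) (score w)) u) (trans
    (Σsplits-cong u λ v r v++r≡u → trans
      (Σsplits-cong v λ p q p++q≡v → two p q r v p++q≡v v++r≡u)
      (trans (Σsplits-weight (avoidsAll? P u) (λ p q → weight (noPair? a b v r) (score (w p q r))) v)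
        (cong (weight (avoidsAll? P u)) (Σsplits-weight (noPair? a b v r) (λ p q → score (w p q r)) v))))
    (Σsplits-weight (avoidsAll? P u) (λ v r → weight (noPair? a b v r) (Σsplits (λ p q → score (w p q r)) v)) u))
    where
    w : Word → Word → Word → Word
    w p q r = lastZero (lastZero (map suc p) q) r
    lower-inner : ∀ p q {v} → p ++ q ≡ v → lower (lastZero (map suc p) q) ≡ v
    lower-inner p q p++q≡v = trans (lower-lastZero (map suc p) q) (trans (cong (_++ q) (lower-map-suc p)) p++q≡v)
    lower-outer : ∀ p q r {v} → p ++ q ≡ v → v ++ r ≡ u → lower (w p q r) ≡ u
    lower-outer p q r p++q≡v v++r≡u = trans (lower-lastZero (lastZero (map suc p) q) r)
      (trans (cong (_++ r) (lower-inner p q p++q≡v)) v++r≡u)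
    two : ∀ p q r v → p ++ q ≡ v → v ++ r ≡ u → weight (avoidsAll? P (w p q r)) (score (w p q r)) ≡
      weight (avoidsAll? P u) (weight (noPair? a b v r) (score (w p q r)))
    two p q r v p++q≡v v++r≡u = weight-× (avoidsAll? P (w p q r)) (avoidsAll? P u) (noPair? a b v r)
      (λ av → let (av′ , ¬z , _) = avoids-lower⁻ (zeroLast a b) zero₁₁₁ (w p q r) av in
        subst (λ w → All (Avoids w) P) (lower-outer p q r p++q≡v v++r≡u) av′ ,
        ¬z ∘ zeroLast⁺ a b (lastZero (map suc p) q) r ∘ subst (HasPair a b) (sym (lower-inner p q p++q≡v)))
      (λ av ¬v → avoids-lower⁺ (zeroLast a b) zero₁₁₁ (w p q r)
        (subst (λ w → All (Avoids w) P) (sym (lower-outer p q r p++q≡v v++r≡u)) av)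
        (¬v ∘ subst (HasPair a b) (lower-inner p q p++q≡v) ∘ zeroLast⁻ a b (lastZero (map suc p) q) r)
        (¬zero₁₁₁-2 p q r))
      (λ _ _ → refl)

-- In the clause for two copies, `m` counts the old letters left of the second 0. For 231, adjacent
-- zeros leave `3 + m` active sites, and a first 0 placed after only `i < m` letters leaves `2 + i`.
doubleRule : GrowthRule
doubleRule 0             g c = Σ< c (λ i → g (2 + i))
doubleRule 1             g c = Σ< c (λ m → g (3 + m) + Σ< m (λ i → g (2 + i)))
doubleRule (suc (suc n)) g c = 0

label₂₃₁-two-apart : ∀ p y q r → ¬ HasPair 0 1 p →
  label₂₃₁ (lastZero (lastZero (map suc p) (y ∷ q)) r) ≡ 2 + length p
label₂₃₁-two-apart p y q r ¬p = trans
  (cong label₂₃₁ (++-assoc (map suc p) (0 ∷ map suc (y ∷ q)) (0 ∷ map suc r))) (trans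
  (count-noPair-0x-dead {0} {1} (map suc p) (suc y) (lastZero (map suc q) r)
    (from (noPair-map-suc {0} {1} p) ¬p) (noAscent-blocked 1 p ¬p) z<s)
  (cong (2 +_) (length-map suc p)))

inner₂₃₁ : ∀ g v r → ¬ HasPair 0 1 v →
  Σsplits (λ p q → g (label₂₃₁ (lastZero (lastZero (map suc p) q) r))) v ≡
  g (3 + length v) + Σ< (length v) (λ i → g (2 + i))
inner₂₃₁ g v r ¬v = trans
  (Σsplits-cong v λ { p []      refl → cong g (trans (label₂₃₁-lastZero 1 p r
                         (subst (λ w → ¬ HasPair 0 1 w) (++-identityʳ p) ¬v)) refl)
                    ; p (y ∷ q) eq → cong g (label₂₃₁-two-apart p y q r (noPair-prefix {0} {1} p (y ∷ q) eq ¬v)) })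
  (go v (λ i → g (2 + i)))
  where
  h : (ℕ → ℕ) → Word → Word → ℕ
  h f p []      = f (suc (length p))
  h f p (y ∷ q) = f (length p)
  go : ∀ v f → Σsplits (h f) v ≡ f (suc (length v)) + Σ< (length v) f
  go []      f = sym (+-identityʳ (f 1))
  go (x ∷ v) f = begin
    f 0 + Σsplits (h f ∘ (x ∷_)) v
      ≡⟨ cong (f 0 +_) (trans (Σsplits-cong v λ { p [] _ → refl ; p (_ ∷ _) _ → refl }) (go v (f ∘ suc))) ⟩
    f 0 + (f (2 + length v) + Σ< (length v) (f ∘ suc))
      ≡⟨ +-assoc (f 0) _ _ ⟨
    f 0 + f (2 + length v) + Σ< (length v) (f ∘ suc)
      ≡⟨ cong (_+ Σ< (length v) (f ∘ suc)) (+-comm (f 0) _) ⟩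
    f (2 + length v) + f 0 + Σ< (length v) (f ∘ suc)
      ≡⟨ +-assoc (f (2 + length v)) _ _ ⟩
    f (2 + length v) + (f 0 + Σ< (length v) (f ∘ suc))
      ≡⟨ cong (f (2 + length v) +_) (Σ<-suc (length v) f) ⟨
    f (2 + length v) + Σ< (suc (length v)) f  ∎
    where open ≡-Reasoning

generatedBy-231-111 : GeneratedBy doubleRule (w231 ∷ w111 ∷ [])
generatedBy-231-111 = record
  { three    = threes
  ; label    = label₂₃₁
  ; label-[] = refl
  ; grow     = grow
  }
  where
  P : List Word
  P = w231 ∷ w111 ∷ []
  grow : ∀ n g u →
    sumOver (λ w → weight (avoidsAll? P w) (g (label₂₃₁ w))) (shuffles (suc n) u) ≡
    weight (avoidsAll? P u) (doubleRule n g (label₂₃₁ u))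
  grow 0 g u = trans
    (grow-once 0 1 (g ∘ label₂₃₁) u (λ p _ → g (2 + length p))
      (λ p q _ ¬p → cong g (trans (cong (λ v → label₂₃₁ (lastZero v q)) (sym (++-identityʳ (map suc p))))
                                  (label₂₃₁-lastZero 0 p q ¬p))))
    (cong (weight (avoidsAll? P u)) (Σsplits-noPair 0 1 (λ i → g (2 + i)) u))
  grow 1 g u = trans (grow-twice 0 1 (g ∘ label₂₃₁) u) (cong (weight (avoidsAll? P u)) (trans
    (Σsplits-cong u λ v r _ → weight-cong (noPair? 0 1 v r) (noPair? 0 1 v r) (mk⇔ id id) (inner₂₃₁ g v r))
    (Σsplits-noPair 0 1 (λ m → g (3 + m) + Σ< m (λ i → g (2 + i))) u)))
  grow (suc (suc n)) g u = trans (sum-shuffles-111 (zeroLast 0 1) (g ∘ label₂₃₁) n u)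
    (sym (weight-0 (avoidsAll? P u)))

label₃₂₁-two : ∀ x p q r → ¬ HasPair 1 0 (x ∷ p) →
  label₃₂₁ (lastZero (lastZero (map suc (x ∷ p)) q) r) ≡ 2 + length p
label₃₂₁-two x p q r ¬p = trans (cong label₃₂₁ (++-assoc (map suc (x ∷ p)) (0 ∷ map suc q) (0 ∷ map suc r)))
  (label₃₂₁-after-0 x p (map suc q ++ 0 ∷ map suc r) ¬p)

-- A first 0 at the very front makes no descent: it adds a site to what the second 0 leaves, and if
-- `v` is empty all old sites survive with two more. A first 0 further right already ends the active
-- sites, wherever the second one is.
inner₃₂₁ : ∀ g v r → ¬ HasPair 1 0 v →
  Σsplits (λ p q → g (label₃₂₁ (lastZero (lastZero (map suc p) q) r))) v ≡
  first (g (2 + label₃₂₁ (v ++ r))) (λ i → g (3 + i)) (length v) + Σ< (length v) (λ i → g (2 + i))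
inner₃₂₁ g []      r _  = trans
  (cong g (trans (label₃₂₁-lastZero 1 r) (+-comm (label₃₂₁ r) 2))) (sym (+-identityʳ _))
inner₃₂₁ g (x ∷ v) r ¬v = cong₂ _+_
  (cong g (trans (label₃₂₁-0s 1 (lastZero (map suc (x ∷ v)) r)) (cong suc (label₃₂₁-after-0 x v (map suc r) ¬v))))
  (trans (Σsplits-cong v λ p q eq → cong g (label₃₂₁-two x p q r
           (noPair-prefix {1} {0} (x ∷ p) q (cong (x ∷_) eq) ¬v)))
         (Σsplits-length (λ i → g (2 + i)) v))

generatedBy-321-111 : GeneratedBy doubleRule (w321 ∷ w111 ∷ [])
generatedBy-321-111 = record
  { three    = threes
  ; label    = label₃₂₁
  ; label-[] = refl
  ; grow     = grow
  }
  where
  P : List Word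
  P = w321 ∷ w111 ∷ []
  -- Here `k` is the number of copies, all at the front in the first summand; its label `k + c` is
  -- the value of `suc k + i` at `i = c - 1`.
  rotate : ∀ k (g : ℕ → ℕ) c → Σ< c (first (g (k + c)) (λ i → g (suc k + i))) ≡ Σ< c (λ i → g (suc k + i))
  rotate k g zero    = refl
  rotate k g (suc m) = trans
    (cong (λ n → Σ< (suc m) (first (g n) (λ i → g (suc k + i)))) (+-suc k m))
    (Σ<-rotate (suc m) (λ i → g (suc k + i)))
  grow : ∀ n g u →
    sumOver (λ w → weight (avoidsAll? P w) (g (label₃₂₁ w))) (shuffles (suc n) u) ≡
    weight (avoidsAll? P u) (doubleRule n g (label₃₂₁ u))
  grow 0 g u = trans
    (grow-once 1 0 (g ∘ label₃₂₁) u (λ p _ → first (g (1 + label₃₂₁ u)) (λ i → g (2 + i)) (length p))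
      (λ { []      q refl _ → cong g (trans (label₃₂₁-lastZero 0 u) (+-comm (label₃₂₁ u) 1))
         ; (x ∷ p) q _ ¬p → cong g (label₃₂₁-after-0 x p (map suc q) ¬p) }))
    (cong (weight (avoidsAll? P u)) (trans
      (Σsplits-noPair 1 0 (first (g (1 + label₃₂₁ u)) (λ i → g (2 + i))) u)
      (rotate 1 g (label₃₂₁ u))))
  grow 1 g u = trans (grow-twice 1 0 (g ∘ label₃₂₁) u) (cong (weight (avoidsAll? P u)) (begin
    Σsplits (λ v r → weight (noPair? 1 0 v r)
      (Σsplits (λ p q → g (label₃₂₁ (lastZero (lastZero (map suc p) q) r))) v)) u
      ≡⟨ Σsplits-cong u (λ v r v++r≡u →
           weight-cong (noPair? 1 0 v r) (noPair? 1 0 v r) (mk⇔ id id) (λ ¬v → trans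
             (inner₃₂₁ g v r ¬v)
             (cong (λ w → first (g (2 + label₃₂₁ w)) (λ i → g (3 + i)) (length v) + rest (length v))
                   v++r≡u))) ⟩
    Σsplits (λ v r → weight (noPair? 1 0 v r) (top (length v) + rest (length v))) u
      ≡⟨ Σsplits-noPair 1 0 (λ m → top m + rest m) u ⟩
    Σ< c (λ m → top m + rest m)
      ≡⟨ Σ<-+ c top rest ⟩
    Σ< c top + Σ< c rest
      ≡⟨ cong (_+ Σ< c rest) (rotate 2 g c) ⟩
    Σ< c (λ m → g (3 + m)) + Σ< c rest
      ≡⟨ Σ<-+ c (λ m → g (3 + m)) rest ⟨
    Σ< c (λ m → g (3 + m) + rest m) ∎))
    where
    open ≡-Reasoning
    c : ℕ
    c = label₃₂₁ u
    top rest : ℕ → ℕ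
    top  = first (g (2 + c)) (λ i → g (3 + i))
    rest = λ m → Σ< m (λ i → g (2 + i))
  grow (suc (suc n)) g u = trans (sum-shuffles-111 (zeroLast 1 0) (g ∘ label₃₂₁) n u)
    (sym (weight-0 (avoidsAll? P u)))

-- The listed equivalences and the soundness of `_≈_`

-- Unlike _∼_, which unfolds, this record lets P and Q be inferred.
infix 4 _≅_
record _≅_ (P Q : List Word) : Set where
  constructor counts
  field same : P ∼ Q

open _≅_

≅-sym : ∀ {P Q} → P ≅ Q → Q ≅ P
≅-sym (counts P∼Q) = counts λ S → sym (P∼Q S)

≅-trans : ∀ {P Q R} → P ≅ Q → Q ≅ R → P ≅ R
≅-trans (counts P∼Q) (counts Q∼R) = counts λ S → trans (P∼Q S) (Q∼R S)

≅-set : ∀ {P Q} → All LengthThree P → All LengthThree Q → (∀ {ρ} → ρ ∈ P ⇔ ρ ∈ Q) → P ≅ Q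
≅-set threeᴾ threeᑫ P⇔Q = counts λ S →
  ≤-antisym (av-⊆ threeᴾ threeᑫ (from P⇔Q) S) (av-⊆ threeᑫ threeᴾ (to P⇔Q) S)

pair-swap : ∀ {ρ σ τ : Word} → ρ ∈ σ ∷ τ ∷ [] → ρ ∈ τ ∷ σ ∷ []
pair-swap (here eq)         = there (here eq)
pair-swap (there (here eq)) = here eq

≅-swap : ∀ {a b c d e f} →
  ((a ∷ b ∷ c ∷ []) ∷ (d ∷ e ∷ f ∷ []) ∷ []) ≅ ((d ∷ e ∷ f ∷ []) ∷ (a ∷ b ∷ c ∷ []) ∷ [])
≅-swap = ≅-set threes threes (mk⇔ pair-swap pair-swap)

≅-reverse : ∀ {P Q} → All LengthThree P → All LengthThree Q → map reverse P ≅ map reverse Q → P ≅ Q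
≅-reverse threeᴾ threeᑫ (counts P∼Q) = counts λ S →
  trans (av-reverse threeᴾ S) (trans (P∼Q S) (sym (av-reverse threeᑫ S)))

≅-complement : ∀ {P Q} → All LengthThree P → All LengthThree Q →
               P ≅ Q → map complement P ≅ map complement Q
≅-complement threeᴾ threeᑫ (counts P∼Q) = counts λ S →
  trans (av-complement threeᴾ S) (trans (P∼Q (opposites S)) (sym (av-complement threeᑫ S)))

generatedBy-≅ : ∀ {Φ P Q} → GeneratedBy Φ P → GeneratedBy Φ Q → P ≅ Q
generatedBy-≅ G H = counts (generatedBy-∼ G H)

111-123≅111-132 : (w111 ∷ w123 ∷ []) ≅ (w111 ∷ w132 ∷ [])
111-123≅111-132 = ≅-reverse threes threes
  (≅-trans ≅-swap (≅-trans (generatedBy-≅ generatedBy-321-111 generatedBy-231-111) ≅-swap))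

-- Reversal followed by complement fixes 111 and 123 and takes 132 to 213, so the preceding
-- equivalence has this one as a consequence.
111-132≅111-213 : (w111 ∷ w132 ∷ []) ≅ (w111 ∷ w213 ∷ [])
111-132≅111-213 = ≅-trans (≅-sym 111-123≅111-132)
  (≅-reverse threes threes (≅-complement threes threes 111-123≅111-132))

111-112≅111-121 : (w111 ∷ w112 ∷ []) ≅ (w111 ∷ w121 ∷ [])
111-112≅111-121 = ≅-reverse threes threes
  (≅-trans ≅-swap (≅-trans (generatedBy-≅ generatedBy-211-111 generatedBy-121-111) ≅-swap))

112-123≅112-213 : (w112 ∷ w123 ∷ []) ≅ (w112 ∷ w213 ∷ [])
112-123≅112-213 = ≅-reverse threes threes (generatedBy-≅ generatedBy-211-321 generatedBy-211-312)

112-213≅121-132 : (w112 ∷ w213 ∷ []) ≅ (w121 ∷ w132 ∷ [])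
112-213≅121-132 = ≅-reverse threes threes (generatedBy-≅ generatedBy-211-312 generatedBy-121-231)

112-212≅121-122 : (w112 ∷ w212 ∷ []) ≅ (w121 ∷ w122 ∷ [])
112-212≅121-122 = ≅-reverse threes threes (generatedBy-≅ generatedBy-211-212 generatedBy-121-221)

121-123≅121-213 : (w121 ∷ w123 ∷ []) ≅ (w121 ∷ w213 ∷ [])
121-123≅121-213 = ≅-reverse threes threes (generatedBy-≅ generatedBy-121-321 generatedBy-121-312)

length≡3⇒three : ∀ ρ → length ρ ≡ 3 → LengthThree ρ
length≡3⇒three (a ∷ b ∷ c ∷ []) _ = a , b , c , refl

patterns₃-three : All LengthThree patterns₃
patterns₃-three = All.map (λ {ρ} → length≡3⇒three ρ)
  (from-yes (All.all? (λ ρ → length ρ ≟ 3) patterns₃))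

elements-three : ∀ P → All LengthThree (elements P)
elements-three P = All.lookup patterns₃-three (p∈ P) ∷ All.lookup patterns₃-three (q∈ P) ∷ []

≈⇒≅ : ∀ {P Q} → P ≈ Q → elements P ≅ elements Q
≈⇒≅ (listed 1a) = 111-123≅111-132
≈⇒≅ (listed 1b) = 111-132≅111-213
≈⇒≅ (listed 2a) = 111-112≅111-121
≈⇒≅ (listed 3a) = 112-123≅112-213
≈⇒≅ (listed 3b) = 112-213≅121-132
≈⇒≅ (listed 4a) = 112-212≅121-122
≈⇒≅ (listed 5a) = 121-123≅121-213
≈⇒≅ (by-reversal P)           = counts (av-reverse (elements-three P))
≈⇒≅ (by-complement {P} {Q} e) = ≅-complement (elements-three P) (elements-three Q) (≈⇒≅ e)
≈⇒≅ (reflexive {P} {Q} P≐Q)   = ≅-set (elements-three P) (elements-three Q) P≐Q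
≈⇒≅ (symmetric e)             = ≅-sym (≈⇒≅ e)
≈⇒≅ (transitive e f)          = ≅-trans (≈⇒≅ e) (≈⇒≅ f)

≡⇒≈ : ∀ {P Q} → elements P ≡ elements Q → P ≈ Q
≡⇒≈ {P} eq = reflexive (subst (λ ws → ∀ {ρ} → ρ ∈ elements P ⇔ ρ ∈ ws) eq (mk⇔ id id))

-- Reduction to representatives

Words² : Set
Words² = Word × Word

listWords : Words² → List Word
listWords (v , w) = v ∷ w ∷ []

infix 4 _↝_
-- Phrased on bare words so that normal forms can be computed; the proofs of membership and
-- distinctness stay inside the quantified pair `P`.
_↝_ : Words² → Words² → Set
v ↝ w = ∀ P → elements P ≡ listWords v → ∃ λ Q → P ≈ Q × elements Q ≡ listWords w

↝-refl : ∀ {v} → v ↝ v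
↝-refl P eq = P , ≡⇒≈ refl , eq

↝-trans : ∀ {v w x} → v ↝ w → w ↝ x → v ↝ x
↝-trans v↝w w↝x P eq with v↝w P eq
... | Q , P≈Q , eq′ with w↝x Q eq′
...   | R , Q≈R , eq″ = R , transitive P≈Q Q≈R , eq″

↝-sym : ∀ {P w} → (p P , q P) ↝ w → w ↝ (p P , q P)
↝-sym {P} P↝w Q eq with P↝w P refl
... | R , P≈R , eq′ = P , transitive (≡⇒≈ (trans eq (sym eq′))) (symmetric P≈R) , refl

swap reverse² : Words² → Words²
swap     (v , w) = (w , v)
reverse² (v , w) = (reverse v , reverse w)

↝-swap : ∀ v → v ↝ swap v
↝-swap v P refl = patternPair (q P) (p P) (q∈ P) (p∈ P) (distinct P ∘ sym) ,
  reflexive (mk⇔ pair-swap pair-swap) , refl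

↝-reverse² : ∀ v → v ↝ reverse² v
↝-reverse² v P refl = P ʳ , by-reversal P , refl

-- The six letters read as a decimal numeral. `orient` takes the least numeral among the four
-- arrangements obtained by swapping and reversing.
key : Words² → ℕ
key (v , w) = foldl (λ n x → 10 * n + x) 0 (v ++ w)

smaller : Words² → Words² → Words²
smaller v w = if key w <ᵇ key v then w else v

↝-smaller : ∀ {u v w} → u ↝ v → u ↝ w → u ↝ smaller v w
↝-smaller {u} {v} {w} u↝v u↝w with key w <ᵇ key v
... | true  = u↝w
... | false = u↝v

orient : Words² → Words²
orient v = smaller (smaller v (swap v)) (smaller (reverse² v) (swap (reverse² v)))

↝-orient : ∀ v → v ↝ orient v
↝-orient v = ↝-smaller (↝-smaller ↝-refl (↝-swap v))
  (↝-smaller (↝-reverse² v) (↝-trans (↝-reverse² v) (↝-swap (reverse² v))))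

_≟²_ : (v w : Words²) → Dec (v ≡ w)
_≟²_ = ×-≡-dec _≟ʷ_ _≟ʷ_

rewrite-by : List (Words² × Words²) → Words² → Words²
rewrite-by []             v = v
rewrite-by ((l , r) ∷ rs) v = if does (v ≟² l) then r else rewrite-by rs v

↝-rewrite-by : ∀ {rs} → All (λ (l , r) → l ↝ r) rs → ∀ v → v ↝ rewrite-by rs v
↝-rewrite-by []                         v = ↝-refl
↝-rewrite-by {(l , r) ∷ _} (l↝r ∷ rs↝) v with v ≟² l
... | yes refl = l↝r
... | no  _    = ↝-rewrite-by rs↝ v

-- Rules are matched after `orient`, so both ends of a relation are moved to their oriented forms;
-- the two equations hold by computation.
≈⇒↝ : ∀ {P Q v w} → P ≈ Q → orient (p P , q P) ≡ v → orient (p Q , q Q) ≡ w → v ↝ w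
≈⇒↝ {P} {Q} P≈Q refl refl = ↝-trans (↝-sym {P} (↝-orient (p P , q P)))
  (↝-trans (λ R eq → Q , transitive (≡⇒≈ eq) P≈Q , refl) (↝-orient (p Q , q Q)))

-- No right side is a left side, so one pass is enough. The complements of (1) and (4) are absent
-- because, once oriented, they only relate pairs that the other rules already identify.
rules : List (Words² × Words²)
rules =
  ((w111 , w132) , (w111 , w123)) ∷
  ((w111 , w213) , (w111 , w123)) ∷
  ((w111 , w121) , (w111 , w112)) ∷
  ((w111 , w212) , (w111 , w122)) ∷
  ((w112 , w213) , (w112 , w123)) ∷
  ((w121 , w132) , (w112 , w123)) ∷
  ((w122 , w132) , (w122 , w123)) ∷
  ((w212 , w213) , (w122 , w123)) ∷
  ((w121 , w122) , (w112 , w212)) ∷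
  ((w121 , w213) , (w121 , w123)) ∷
  ((w132 , w212) , (w123 , w212)) ∷
  []

rules-sound : All (λ (l , r) → l ↝ r) rules
rules-sound =
  ≈⇒↝ (symmetric (listed 1a)) refl refl ∷
  ≈⇒↝ (symmetric (transitive (listed 1a) (listed 1b))) refl refl ∷
  ≈⇒↝ (symmetric (listed 2a)) refl refl ∷
  ≈⇒↝ (by-complement (symmetric (listed 2a))) refl refl ∷
  ≈⇒↝ (symmetric (listed 3a)) refl refl ∷
  ≈⇒↝ (symmetric (transitive (listed 3a) (listed 3b))) refl refl ∷
  ≈⇒↝ (by-complement (symmetric (listed 3a))) refl refl ∷
  ≈⇒↝ (by-complement (symmetric (transitive (listed 3a) (listed 3b)))) refl refl ∷
  ≈⇒↝ (symmetric (listed 4a)) refl refl ∷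
  ≈⇒↝ (symmetric (listed 5a)) refl refl ∷
  ≈⇒↝ (by-complement (symmetric (listed 5a))) refl refl ∷
  []

normalise : Words² → Words²
normalise v = rewrite-by rules (orient v)

↝-normalise : ∀ v → v ↝ normalise v
↝-normalise v = ↝-trans (↝-orient v) (↝-rewrite-by rules-sound (orient v))

representatives : List Words²
representatives =
  (w111 , w112) ∷ (w111 , w122) ∷ (w111 , w123) ∷ (w112 , w121) ∷
  (w112 , w122) ∷ (w112 , w123) ∷ (w112 , w132) ∷ (w112 , w211) ∷
  (w112 , w212) ∷ (w112 , w221) ∷ (w112 , w231) ∷ (w112 , w312) ∷
  (w112 , w321) ∷ (w121 , w123) ∷ (w121 , w212) ∷ (w122 , w123) ∷
  (w122 , w212) ∷ (w122 , w213) ∷ (w122 , w221) ∷ (w122 , w231) ∷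
  (w122 , w312) ∷ (w122 , w321) ∷ (w123 , w132) ∷ (w123 , w212) ∷
  (w123 , w213) ∷ (w123 , w231) ∷ (w123 , w312) ∷ (w123 , w321) ∷
  (w132 , w213) ∷ (w132 , w231) ∷ (w132 , w312) ∷ (w213 , w312) ∷ []

normalise-representative :
  All (λ v → All (λ w → v ≡ w ⊎ normalise (v , w) ∈ representatives) patterns₃) patterns₃
normalise-representative = from-yes (All.all? (λ v → All.all? (λ w →
  v ≟ʷ w ⊎-dec Any.any? (normalise (v , w) ≟²_) representatives) patterns₃) patterns₃)

representative : ∀ P → ∃ λ Q → P ≈ Q × (p Q , q Q) ∈ representatives
representative P = go (normalise (p P , q P)) (↝-normalise (p P , q P) P refl)
  (All.lookup (All.lookup normalise-representative (p∈ P)) (q∈ P))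
  where
  go : ∀ v → (∃ λ Q → P ≈ Q × elements Q ≡ listWords v) → p P ≡ q P ⊎ v ∈ representatives →
       ∃ λ Q → P ≈ Q × (p Q , q Q) ∈ representatives
  go v _                (inj₁ eq) = contradiction eq (distinct P)
  go v (Q , P≈Q , refl) (inj₂ v∈) = Q , P≈Q , v∈

-- Separation of the representatives

occurs? : ∀ {T : TripleRelation} → (∀ x y z → Dec (T x y z)) → ∀ w → Dec (Occurs T w)
occurs?         T? []      = no λ { (_ , _ , _ , () , _) }
occurs? {T = T} T? (x ∷ w) = map′ ⇒ ⇐ (somePair? (T? x) w ⊎-dec occurs? T? w)
  where
  ⇒ : (∃₂ λ y z → y ∷ z ∷ [] ⊆ w × T x y z) ⊎ Occurs T w → Occurs T (x ∷ w)
  ⇒ (inj₁ (y , z , τ , xyz))     = x , y , z , refl ∷ τ , xyz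
  ⇒ (inj₂ (u , y , z , τ , uyz)) = u , y , z , x ∷ʳ τ , uyz
  ⇐ : Occurs T (x ∷ w) → (∃₂ λ y z → y ∷ z ∷ [] ⊆ w × T x y z) ⊎ Occurs T w
  ⇐ (u , y , z , _ ∷ʳ τ , uyz)   = inj₂ (u , y , z , τ , uyz)
  ⇐ (u , y , z , refl ∷ τ , xyz) = inj₁ (y , z , τ , xyz)

-- avoids? tries all triples of positions, which is too slow for evaluating av on
-- the separating multisets.
Misses : Word → Word → Set
Misses w (a ∷ b ∷ c ∷ []) = ¬ Occurs (Pattern a b c) w
Misses w _                = ⊤

misses? : ∀ w ρ → Dec (Misses w ρ)
misses? w (a ∷ b ∷ c ∷ []) =
  ¬? (occurs? (λ x y z → like? a b x y ×-dec like? b c y z ×-dec like? a c x z) w)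
misses? w []                    = yes tt
misses? w (_ ∷ [])              = yes tt
misses? w (_ ∷ _ ∷ [])          = yes tt
misses? w (_ ∷ _ ∷ _ ∷ _ ∷ _)   = yes tt

number : ∀ {k} → Vec ℕ k → List Word → ℕ
number as P = length (filter (λ w → All.all? (misses? w) P) (arrangements as))

av≡number : ∀ {P} → All LengthThree P → ∀ S → av S P ≡ number (Multiset.mult S) P
av≡number {P} three S = av≡length (λ w → All.all? (misses? w) P) S P
  (λ w → avoids-all-suc⁺ three w ∘ misses⇒ three)
  (λ w → misses⇐ three ∘ avoids-all-suc⁻ three w)
  where
  misses⇒ : ∀ {P w} → All LengthThree P → All (Misses w) P → All (Avoids w) P
  misses⇒             []                           []       = []
  misses⇒ {w = w} ((a , b , c , refl) ∷ three) (m ∷ ms) = m ∘ contains⇒occurs w ∷ misses⇒ three ms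
  misses⇐ : ∀ {P w} → All LengthThree P → All (Avoids w) P → All (Misses w) P
  misses⇐             []                           []       = []
  misses⇐ {w = w} ((a , b , c , refl) ∷ three) (m ∷ ms) = m ∘ occurs⇒contains w ∷ misses⇐ three ms

multiset₁₁₂₁ multiset₂₂₁ multiset₁₃₁ : Multiset
multiset₁₁₂₁ = multiset 4 (s≤s z≤n) (1 ∷ 1 ∷ 2 ∷ 1 ∷ [])
  (s≤s z≤n Vecᴬ.∷ s≤s z≤n Vecᴬ.∷ s≤s z≤n Vecᴬ.∷ s≤s z≤n Vecᴬ.∷ Vecᴬ.[])
multiset₂₂₁  = multiset 3 (s≤s z≤n) (2 ∷ 2 ∷ 1 ∷ [])
  (s≤s z≤n Vecᴬ.∷ s≤s z≤n Vecᴬ.∷ s≤s z≤n Vecᴬ.∷ Vecᴬ.[])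
multiset₁₃₁  = multiset 3 (s≤s z≤n) (1 ∷ 3 ∷ 1 ∷ [])
  (s≤s z≤n Vecᴬ.∷ s≤s z≤n Vecᴬ.∷ s≤s z≤n Vecᴬ.∷ Vecᴬ.[])

separatingMultisets : List Multiset
separatingMultisets = multiset₁₁₂₁ ∷ multiset₂₂₁ ∷ multiset₁₃₁ ∷ []

opaque
  -- Opaque, so that comparing types elsewhere never evaluates the counts; the distinctness check,
  -- which must evaluate them, lives in the same block.
  signature : List Word → List ℕ
  signature P = map (λ S → number (Multiset.mult S) P) separatingMultisets

  signatures-distinct : Unique (map (signature ∘ listWords) representatives)
  signatures-distinct = from-yes
    (AllPairs.allPairs? (λ m n → ¬? (≡-dec _≟_ m n)) (map (signature ∘ listWords) representatives))

  signature-cong : ∀ {P Q} → All LengthThree P → All LengthThree Q → P ≅ Q → signature P ≡ signature Q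
  signature-cong {P} {Q} threeᴾ threeᑫ (counts P∼Q) = map-cong
    {f = λ S → number (Multiset.mult S) P} {g = λ S → number (Multiset.mult S) Q}
    (λ S → trans (sym (av≡number threeᴾ S)) (trans (P∼Q S) (av≡number threeᑫ S)))
    separatingMultisets

unique-map⇒injective : ∀ {A B : Set} (f : A → B) {xs x y} → Unique (map f xs) →
                       x ∈ xs → y ∈ xs → f x ≡ f y → x ≡ y
unique-map⇒injective f _            (here refl) (here refl) _  = refl
unique-map⇒injective f (fx≢ ∷ _)    (here refl) (there y∈)  eq =
  contradiction eq (All.lookup fx≢ (∈-map⁺ f y∈))
unique-map⇒injective f (fx≢ ∷ _)    (there x∈)  (here refl) eq =
  contradiction (sym eq) (All.lookup fx≢ (∈-map⁺ f x∈))
unique-map⇒injective f (_   ∷ uniq) (there x∈)  (there y∈)  eq = unique-map⇒injective f uniq x∈ y∈ eq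

-- Soundness of `_≈_` carries the equivalence over to the representatives; these then share a
-- signature, hence coincide, and the two reductions join up.
≅⇒≈ : ∀ {P Q} → elements P ≅ elements Q → P ≈ Q
≅⇒≈ {P} {Q} P≅Q = go (representative P) (representative Q)
  where
  go : (∃ λ P′ → P ≈ P′ × (p P′ , q P′) ∈ representatives) →
       (∃ λ Q′ → Q ≈ Q′ × (p Q′ , q Q′) ∈ representatives) → P ≈ Q
  go (P′ , P≈P′ , P′∈) (Q′ , Q≈Q′ , Q′∈) = transitive P≈P′ (transitive (≡⇒≈ (cong listWords same-words))
                                                                       (symmetric Q≈Q′))
    where
    same-words : (p P′ , q P′) ≡ (p Q′ , q Q′)
    same-words = unique-map⇒injective (signature ∘ listWords) signatures-distinct P′∈ Q′∈
      (signature-cong (elements-three P′) (elements-three Q′)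
        (≅-trans (≅-sym (≈⇒≅ P≈P′)) (≅-trans P≅Q (≈⇒≅ Q≈Q′))))

mainTheorem16 : (       
    ((w111 ∷ w123 ∷ []) ∼ (w111 ∷ w132 ∷ [])) ×
    ((w111 ∷ w132 ∷ []) ∼ (w111 ∷ w213 ∷ [])) ×
    ((w111 ∷ w112 ∷ []) ∼ (w111 ∷ w121 ∷ [])) ×
    ((w112 ∷ w123 ∷ []) ∼ (w112 ∷ w213 ∷ [])) ×
    ((w112 ∷ w213 ∷ []) ∼ (w121 ∷ w132 ∷ [])) ×
    ((w112 ∷ w212 ∷ []) ∼ (w121 ∷ w122 ∷ [])) ×
    ((w121 ∷ w123 ∷ []) ∼ (w121 ∷ w213 ∷ [])) ) ×
    (∀ (P Q : PatternPair) →
    (PatternPair.elements P ∼ PatternPair.elements Q) ⇔ (P ≈ Q))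
mainTheorem16 =
  ( same 111-123≅111-132 , same 111-132≅111-213 , same 111-112≅111-121 , same 112-123≅112-213
  , same 112-213≅121-132 , same 112-212≅121-122 , same 121-123≅121-213 ) ,
  λ P Q → mk⇔ (λ P∼Q → ≅⇒≈ (counts P∼Q)) (λ P≈Q → same (≈⇒≅ P≈Q))
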